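{- Let $n \geq 3$, $r \geq 2$ and $0\le \ell < d \leq \left\lfloor \frac{n+\ell-1}{2} \right\rfloor$ be integers. Suppose that $G$ is an $n$-vertex graph that is not $\ell$-hamiltonian, with minimum degree $\delta(G) \geq d$, such that $$N(G, K_r) > \max\left\{ h_r(n,d+1,\ell),\; h_r\left(n, \left\lfloor \tfrac{n+\ell-1}{2}\right\rfloor, \ell\right)\right\}.$$ Then $G$ is (isomorphic to) a subgraph of either $H_{n,d,\ell}$ or $H'_{n,d,\ell}$.
   Context: All graphs are finite and simple. A linear forest is a graph that is a vertex-disjoint union of paths. For an integer $\ell\ge 0$, a graph $G$ is called $\ell$-hamiltonian if for every linear forest $F$ with exactly $\ell$ edges contained in $G$, $G$ has a hamiltonian cycle containing all edges of $F$ (so $0$-hamiltonian means hamiltonian). $N(G,K_r)$ denotes the number of copies of the complete graph $K_r$ in $G$ (i.e. the number of $r$-element vertex subsets inducing a clique). For integers $0\le \ell<d\le \lfloor (n+\ell-1)/2\rfloor$: - $H_{n,d,\ell}$ is the $n$-vertex graph obtained from a copy of $K_{n-d+\ell}$ with vertex set $A$ by adding $d-\ell$ new vertices, each of degree $d$ and each adjacent to exactly the vertices of one common fixed set $B\subseteq A$ with $|B|=d$ (the new vertices are pairwise non-adjacent). - $H'_{n,d,\ell}$ is the $n$-vertex graph obtained from a copy of $K_{n-d+\ell}$ and a copy of $K_{d+1}$ by identifying $\ell+1$ vertices (i.e. it is the union of a clique on $n-d+\ell$ vertices and a clique on $d+1$ vertices sharing exactly $\ell+1$ vertices). The function $h_r$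 is given by the formula $h_r(n,d,\ell) = \binom{n-d+\ell}{r} + (d-\ell)\binom{d}{r-1}$ (the number of copies of $K_r$ in $H_{n,d,\ell}$ when $0\le \ell<d\le \lfloor (n+\ell-1)/2\rfloor$; the formula is used also for the value $d+1$). -}

module Defs where

open import Data.Fin.Base using (Fin; toℕ)
open import Data.Fin.Properties using (_≟_; _<?_; all?)
open import Data.Fin.Subset using (Subset; inside; outside; _∈_; ∣_∣)
open import Data.Fin.Subset.Properties using (_∈?_)
open import Data.List.Base
  using (List; []; _∷_; [_]; _++_; _∷ʳ_; map; concat; zip; drop; filter;
         length; allFin; cartesianProduct)
open import Data.List.Extrema using (min)
open import Data.List.NonEmpty.Base using (List⁺; toList)
open import Data.List.Relation.Binary.Permutation.Propositional using (_↭_)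
open import Data.List.Relation.Unary.Any using (Any)
open import Data.List.Relation.Unary.Linked using (Linked)
import Data.List.Membership.Propositional as List
open import Data.Nat.Base using (ℕ; suc; _+_; _*_; _∸_; _≤_; _<_)
open import Data.Nat.Combinatorics using (_C_)
import Data.Nat.Properties as ℕₚ
open import Data.Product.Base using (Σ-syntax; _×_; _,_)
open import Data.Sum.Base using (_⊎_)
import Data.Sum.Base as Sum
open import Data.Vec.Base using ([]; _∷_)
open import Function.Bundles using (_⇔_)
open import Function.Definitions using (Injective)
open import Level using (0ℓ)
open import Relation.Binary.Core using (Rel)
open import Relation.Binary.Definitions using (Symmetric; Irreflexive; Decidable)
open import Relation.Binary.PropositionalEquality using (_≡_; _≢_; ≢-sym)
open import Relation.Nullary using (¬_; Dec; ¬?; _×-dec_; _⊎-dec_; _→-dec_)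

------------------------------------------------------------------------
-- Finite simple graphs on the vertex set Fin n

record Graph (n : ℕ) : Set₁ where
  field
    Adj    : Rel (Fin n) 0ℓ
    sym    : Symmetric Adj
    irrefl : Irreflexive _≡_ Adj
    adj?   : Decidable Adj

open Graph public using (Adj; adj?)

private
  variable
    m n : ℕ

degree : Graph n → Fin n → ℕ
degree {n} G v = length (filter (adj? G v) (allFin n))

-- Every degree is below n, so the default value n of `min` is attained only
-- when there are no vertices.
δ : Graph n → ℕ
δ {n} G = min ℕₚ.≤-totalOrder n (map (degree G) (allFin n))

edgeCount : Graph n → ℕ
edgeCount {n} G =
  length (filter (λ (u , v) → (u <? v) ×-dec adj? G u v)
                 (cartesianProduct (allFin n) (allFin n)))

-- Not required to be an induced subgraph.
_⊆ᴳ_ : Graph n → Graph n → Set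
F ⊆ᴳ G = ∀ u v → Adj F u v → Adj G u v

_IsomorphicToSubgraphOf_ : Graph m → Graph n → Set
_IsomorphicToSubgraphOf_ {m} {n} G H =
  Σ[ f ∈ (Fin m → Fin n) ]
    Injective _≡_ _≡_ f ×
    (∀ u v → Adj G u v → Adj H (f u) (f v))

------------------------------------------------------------------------
-- Cliques

IsClique : Graph n → Subset n → Set
IsClique G S = ∀ u v → u ∈ S → v ∈ S → u ≢ v → Adj G u v

isClique? : (G : Graph n) (S : Subset n) → Dec (IsClique G S)
isClique? G S =
  all? λ u → all? λ v →
    (u ∈? S) →-dec ((v ∈? S) →-dec (¬? (u ≟ v) →-dec adj? G u v))

subsets : ∀ n → List (Subset n)
subsets 0       = [ [] ]
subsets (suc n) = map (inside ∷_) (subsets n) ++ map (outside ∷_) (subsets n)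

-- N(G, K_r)
cliqueCount : Graph n → ℕ → ℕ
cliqueCount {n} G r =
  length (filter (λ S → (∣ S ∣ ℕₚ.≟ r) ×-dec isClique? G S) (subsets n))

------------------------------------------------------------------------
-- Walks, linear forests and hamiltonian cycles

steps : {A : Set} → List A → List (A × A)
steps xs = zip xs (drop 1 xs)

-- uv is one of the (undirected) edges of the walk xs.
Traverses : {A : Set} → List A → A → A → Set
Traverses xs u v = (u , v) List.∈ steps xs ⊎ (v , u) List.∈ steps xs

-- The vertices of F are split into disjoint paths whose edges are exactly
-- those of F.  A linear forest contained in an n-vertex graph need not meet
-- every vertex; it is represented on all of Fin n by letting the missed
-- vertices be one-vertex paths, which changes neither its edges nor their
-- number.
IsLinearForest : Graph n → Set
IsLinearForest {n} F =
  Σ[ paths ∈ List (List⁺ (Fin n)) ]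
    concat (map toList paths) ↭ allFin n ×
    (∀ u v → Adj F u v ⇔ Any (λ P → Traverses (toList P) u v) paths)

close : {A : Set} → List A → List A
close []       = []
close (x ∷ xs) = (x ∷ xs) ∷ʳ x

record HamiltonianCycle (G : Graph n) : Set where
  field
    vertices : List (Fin n)
    spanning : vertices ↭ allFin n
    -- excludes the closed walk u, v, u on a single edge
    3≤length : 3 ≤ length vertices
    adjacent : Linked (Adj G) (close vertices)

_ContainsEdgesOf_ : {G : Graph n} → HamiltonianCycle G → Graph n → Set
Z ContainsEdgesOf F = ∀ u v → Adj F u v → Traverses (close vertices) u v
  where open HamiltonianCycle Z

_-Hamiltonian_ : ℕ → Graph n → Set₁
ℓ -Hamiltonian G =
  ∀ F → IsLinearForest F → edgeCount F ≡ ℓ → F ⊆ᴳ G →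
  Σ[ Z ∈ HamiltonianCycle G ] Z ContainsEdgesOf F

------------------------------------------------------------------------
-- The extremal graphs, for ℓ < d ≤ ⌊ n + ℓ ∸ 1 /2⌋ (whence d + 2 ≤ n and
-- d ≤ n ∸ d + ℓ, so that no subtraction below is truncated)

-- A is the set of the first n − d + ℓ vertices and B the set of the first d.
H : ∀ n d ℓ → Graph n
H n d ℓ = record
  { Adj    = λ u v → u ≢ v × (Joined u v ⊎ Joined v u)
  ; sym    = λ (u≢v , j) → ≢-sym u≢v , Sum.swap j
  ; irrefl = λ u≡v (u≢v , _) → u≢v u≡v
  ; adj?   = λ u v → ¬? (u ≟ v) ×-dec (joined? u v ⊎-dec joined? v u)
  }
  where
  InA InB : Fin n → Set
  InA u = toℕ u < n ∸ d + ℓ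
  InB u = toℕ u < d

  inA? : ∀ u → Dec (InA u)
  inA? u = toℕ u ℕₚ.<? n ∸ d + ℓ

  inB? : ∀ u → Dec (InB u)
  inB? u = toℕ u ℕₚ.<? d

  Joined : Rel (Fin n) 0ℓ
  Joined u v = (InA u × InA v) ⊎ (InB u × ¬ InA v)

  joined? : Decidable Joined
  joined? u v = (inA? u ×-dec inA? v) ⊎-dec (inB? u ×-dec ¬? (inA? v))

-- The cliques are the first n − d + ℓ and the last d + 1 vertices, which
-- overlap in ℓ + 1 vertices.
H′ : ∀ n d ℓ → Graph n
H′ n d ℓ = record
  { Adj    = λ u v → u ≢ v × ((InP u × InP v) ⊎ (InQ u × InQ v))
  ; sym    = λ (u≢v , j) → ≢-sym u≢v ,
               Sum.map (λ (p , q) → q , p) (λ (p , q) → q , p) j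
  ; irrefl = λ u≡v (u≢v , _) → u≢v u≡v
  ; adj?   = λ u v → ¬? (u ≟ v) ×-dec
               ((inP? u ×-dec inP? v) ⊎-dec (inQ? u ×-dec inQ? v))
  }
  where
  InP InQ : Fin n → Set
  InP u = toℕ u < n ∸ d + ℓ
  InQ u = n ∸ suc d ≤ toℕ u

  inP? : ∀ u → Dec (InP u)
  inP? u = toℕ u ℕₚ.<? n ∸ d + ℓ

  inQ? : ∀ u → Dec (InQ u)
  inQ? u = n ∸ suc d ℕₚ.≤? toℕ u

h : (r n d ℓ : ℕ) → ℕ
h r n d ℓ = (n ∸ d + ℓ) C r + (d ∸ ℓ) * (d C (r ∸ 1))

{-# OPTIONS --safe #-}
module Submission where

-- Fix a linear forest F with ℓ edges in G, let m = ⌊(n+ℓ−1)/2⌋ and m ≥ j ≥ ℓ. If j − ℓ vertices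
-- have degree at most j, then deleting them one by one shows N(G, K_r) ≤ h_r(n, j, ℓ). As h_r is
-- convex in j, the hypothesis makes the number of vertices of degree ≤ j smaller than j − ℓ for
-- all d < j ≤ m and for j = m. This condition, δ ≥ d and F ⊆ G survive adding edges, so one can
-- induct on the number of non-edges and show that F lies on a hamiltonian cycle or that G has
-- the shape of a subgraph of H or H′.
--
-- If u ≁ v and deg u + deg v ≥ n + ℓ, a hamiltonian cycle of G + uv through F can be rerouted
-- around uv (Bondy–Chvátal; the at most ℓ edges of F must not be cut). Otherwise, unless G is
-- complete, a non-adjacent pair of maximal degree sum shows that the set D of vertices of degree
-- d has exactly d − ℓ elements and that G − D is complete. Then all vertices of D have the same
-- set W of neighbours outside D. If D is independent, G is a subgraph of H; if D is a clique, of
-- H′. Otherwise pick non-adjacent u, y ∈ D, a neighbour t ∈ D of y, and x ∉ D ∪ W. By induction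
-- G + ux may be assumed to have the cycle, which leaves a hamiltonian path u … x of G through F.
-- Now deg u + deg x ≥ n + ℓ − 1, so if no rerouting closes the path, the counting is tight at
-- every step of it; this lets y be moved to the front of the path, and tightness of the new path
-- lets y be inserted into the cycle formed by its other vertices, between t and its successor.

open import Defs
open import Data.Bool.Base using (Bool; true; false; if_then_else_)
open import Data.Empty using (⊥)
open import Data.Fin.Base as Fin using (Fin; zero; suc; toℕ; fromℕ<)
open import Data.Fin.Properties using (_≟_; _<?_; <-cmp; any?; all?; toℕ-fromℕ<)
open import Data.Fin.Subset using (Subset; inside; outside; _∈_; _∉_; _⊆_; ∣_∣; ⊤; _-_)
open import Data.Fin.Subset.Properties
  using (_∈?_; _⊆?_; out⊆; in⊆in; drop-∷-⊆; drop-there; ∈⊤; ∣⊤∣≡n; p─⊥≡p; p─q⊆p; x∈p∧x≢y⇒x∈p-y; anySubset?)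
open import Data.List.Base
  using (List; []; _∷_; _++_; map; concat; filter; take; length; allFin; cartesianProduct)
import Data.List.Membership.Propositional as List
open import Data.List.Membership.Propositional.Properties using (∈-allFin; ∈-map⁺)
open import Data.List.NonEmpty.Base using (List⁺; toList)
open import Data.List.Properties using (map-++; map-∘; map-tabulate; length-tabulate; length-take)
open import Data.List.Relation.Binary.Permutation.Propositional
  using (_↭_; ↭-refl; ↭-sym; ↭-trans; ↭-reflexive; ↭⇒↭ₛ; prep)
import Data.List.Relation.Binary.Permutation.Propositional.Properties as Perm
import Data.List.Relation.Binary.Permutation.Setoid.Properties as SetoidPerm
open import Data.List.Relation.Unary.All as All using (All; []; _∷_)
import Data.List.Relation.Unary.All.Properties as All
open import Data.List.Relation.Unary.AllPairs using ([]; _∷_)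
open import Data.List.Relation.Unary.Any using (Any; here; there)
open import Data.List.Relation.Unary.Linked using (Linked; [-]; _∷_)
open import Data.List.Relation.Unary.Unique.Propositional using (Unique)
import Data.List.Relation.Unary.Unique.Propositional.Properties as Unique
open import Data.Nat.Base hiding (∣_-_∣)
open import Data.Nat.Combinatorics using (_C_; nCk≡nC[n∸k]; nCn≡1; nCk+nC[k+1]≡[n+1]C[k+1])
open import Data.Nat.ListAction using (sum)
open import Data.Nat.ListAction.Properties using (sum-++; sum-↭)
open import Data.Nat.Properties as ℕ hiding (_≟_; _<?_; <-cmp)
open import Data.Nat.Tactic.RingSolver using (solve-∀)
open import Data.List.Extrema ≤-totalOrder using (min≤xs)
open import Data.Product.Base using (Σ-syntax; ∃-syntax; _×_; _,_; proj₁; proj₂; map₂)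
open import Data.Sum.Base as Sum using (_⊎_; inj₁; inj₂)
import Data.Unit.Base as Unit
open import Data.Vec.Base as Vec using ([]; _∷_; here; there)
import Data.Vec.Properties as Vec
open import Function.Base using (_∘_; id)
open import Function.Bundles using (Equivalence)
open import Function.Definitions using (Injective)
open import Level using (0ℓ)
open import Relation.Binary.Definitions using (tri<; tri≈; tri>)
open import Relation.Binary.PropositionalEquality hiding ([_])
open import Relation.Nullary using (¬_; Dec; yes; no; does; ¬?; _×-dec_; _⊎-dec_; _→-dec_; contradiction)
open import Relation.Nullary.Decidable using (decidable-stable)
open import Relation.Unary using (Decidable; Pred)

-- Counting

private
  variable
    A B : Set
    P Q R : Set
    n : ℕ

-- The Iverson bracket. Cardinalities become sums of brackets, so that counting arguments reduce to
-- termwise inequalities.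
⟦_⟧ : Dec P → ℕ
⟦ P? ⟧ = if does P? then 1 else 0

⟦⟧-true : (P? : Dec P) → P → ⟦ P? ⟧ ≡ 1
⟦⟧-true (yes _) _ = refl
⟦⟧-true (no ¬p) p = contradiction p ¬p

⟦⟧-false : (P? : Dec P) → ¬ P → ⟦ P? ⟧ ≡ 0
⟦⟧-false (yes p) ¬p = contradiction p ¬p
⟦⟧-false (no _)  _  = refl

⟦⟧-pos : (P? : Dec P) → 0 < ⟦ P? ⟧ → P
⟦⟧-pos (yes p) _ = p

⟦⟧≤1 : (P? : Dec P) → ⟦ P? ⟧ ≤ 1
⟦⟧≤1 (yes _) = ≤-refl
⟦⟧≤1 (no _)  = z≤n

⟦⟧-mono : (P? : Dec P) (Q? : Dec Q) → (P → Q) → ⟦ P? ⟧ ≤ ⟦ Q? ⟧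
⟦⟧-mono (yes p) Q? f = ≤-reflexive (sym (⟦⟧-true Q? (f p)))
⟦⟧-mono (no _)  Q? f = z≤n

⟦⟧-cong : (P? : Dec P) (Q? : Dec Q) → (P → Q) → (Q → P) → ⟦ P? ⟧ ≡ ⟦ Q? ⟧
⟦⟧-cong P? Q? f g = ≤-antisym (⟦⟧-mono P? Q? f) (⟦⟧-mono Q? P? g)

⟦⟧-cover : (P? : Dec P) (Q? : Dec Q) (R? : Dec R) → (P → Q ⊎ R) → ⟦ P? ⟧ ≤ ⟦ Q? ⟧ + ⟦ R? ⟧
⟦⟧-cover (no _)  Q? R? f = z≤n
⟦⟧-cover (yes p) Q? R? f with f p
... | inj₁ q = ≤-trans (≤-reflexive (sym (⟦⟧-true Q? q))) (m≤m+n _ _)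
... | inj₂ r = ≤-trans (≤-reflexive (sym (⟦⟧-true R? r))) (m≤n+m _ _)

⟦⟧-disjoint : (P? : Dec P) (Q? : Dec Q) (R? : Dec R) → (P → R) → (Q → R) → (P → ¬ Q) →
              ⟦ P? ⟧ + ⟦ Q? ⟧ ≤ ⟦ R? ⟧
⟦⟧-disjoint (yes p) Q? R? f g h rewrite ⟦⟧-false Q? (h p) | ⟦⟧-true R? (f p) = ≤-refl
⟦⟧-disjoint (no _)  Q? R? f g h = ⟦⟧-mono Q? R? g

∑ : List A → (A → ℕ) → ℕ
∑ xs f = sum (map f xs)

∑-++ : (xs ys : List A) (f : A → ℕ) → ∑ (xs ++ ys) f ≡ ∑ xs f + ∑ ys f
∑-++ xs ys f = trans (cong sum (map-++ f xs ys)) (sum-++ (map f xs) (map f ys))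

∑-map : (g : A → B) (xs : List A) (f : B → ℕ) → ∑ (map g xs) f ≡ ∑ xs (f ∘ g)
∑-map g xs f = cong sum (sym (map-∘ xs))

∑-↭ : {xs ys : List A} (f : A → ℕ) → xs ↭ ys → ∑ xs f ≡ ∑ ys f
∑-↭ f p = sum-↭ (Perm.map⁺ f p)

∑-mono : (xs : List A) {f g : A → ℕ} → (∀ x → f x ≤ g x) → ∑ xs f ≤ ∑ xs g
∑-mono []       f≤g = z≤n
∑-mono (x ∷ xs) f≤g = +-mono-≤ (f≤g x) (∑-mono xs f≤g)

∑-mono-< : ∀ {A : Set} {xs : List A} {x : A} {f g : A → ℕ} → (∀ x → f x ≤ g x) →
           x List.∈ xs → f x < g x → ∑ xs f < ∑ xs g
∑-mono-< {xs = _ ∷ xs} f≤g (here refl) lt = +-mono-<-≤ lt (∑-mono xs f≤g)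
∑-mono-< f≤g (there x∈) lt = +-mono-≤-< (f≤g _) (∑-mono-< f≤g x∈ lt)

∑-cong : (xs : List A) {f g : A → ℕ} → (∀ x → f x ≡ g x) → ∑ xs f ≡ ∑ xs g
∑-cong []       f≡g = refl
∑-cong (x ∷ xs) f≡g = cong₂ _+_ (f≡g x) (∑-cong xs f≡g)

∑-zero : (xs : List A) → ∑ xs (λ _ → 0) ≡ 0
∑-zero []       = refl
∑-zero (x ∷ xs) = ∑-zero xs

interchange : ∀ a b c d → (a + b) + (c + d) ≡ (a + c) + (b + d)
interchange = solve-∀

∑-+ : (xs : List A) (f g : A → ℕ) → ∑ xs (λ x → f x + g x) ≡ ∑ xs f + ∑ xs g
∑-+ []       f g = refl
∑-+ (x ∷ xs) f g rewrite ∑-+ xs f g = interchange (f x) (g x) (∑ xs f) (∑ xs g)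

∑-∈ : {xs : List A} {x : A} (f : A → ℕ) → x List.∈ xs → f x ≤ ∑ xs f
∑-∈ f (here refl) = m≤m+n _ _
∑-∈ f (there x∈)  = ≤-trans (∑-∈ f x∈) (m≤n+m _ _)

∑-< : (xs : List A) (f g : A → ℕ) → ∑ xs f < ∑ xs g → ∃[ x ] f x < g x
∑-< (x ∷ xs) f g lt with f x ℕ.<? g x
... | yes p = x , p
... | no ¬p = ∑-< xs f g (+-cancelˡ-< (f x) _ _ (<-≤-trans lt (+-monoˡ-≤ (∑ xs g) (≮⇒≥ ¬p))))

length-filter-∑ : {P : Pred A 0ℓ} (P? : Decidable P) (xs : List A) →
                  length (filter P? xs) ≡ ∑ xs (λ x → ⟦ P? x ⟧)
length-filter-∑ P? [] = refl
length-filter-∑ P? (x ∷ xs) with does (P? x)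
... | true  = cong suc (length-filter-∑ P? xs)
... | false = length-filter-∑ P? xs

∑-cartesianProduct : (xs : List A) (ys : List B) (f : A × B → ℕ) →
                     ∑ (cartesianProduct xs ys) f ≡ ∑ xs (λ x → ∑ ys (λ y → f (x , y)))
∑-cartesianProduct [] ys f = refl
∑-cartesianProduct (x ∷ xs) ys f = trans (∑-++ (map (x ,_) ys) _ f)
  (cong₂ _+_ (∑-map (x ,_) ys f) (∑-cartesianProduct xs ys f))

# : {P : Pred (Fin n) 0ℓ} → Decidable P → ℕ
# {n} P? = ∑ (allFin n) (λ v → ⟦ P? v ⟧)

∑-allFin-suc : (f : Fin (suc n) → ℕ) → ∑ (allFin (suc n)) f ≡ f zero + ∑ (allFin n) (f ∘ suc)
∑-allFin-suc f = cong (λ xs → f zero + sum xs)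
  (trans (map-tabulate suc f) (sym (map-tabulate (λ i → i) (f ∘ suc))))

module _ {P Q : Pred (Fin n) 0ℓ} (P? : Decidable P) (Q? : Decidable Q) where

  #-mono : (∀ v → P v → Q v) → # P? ≤ # Q?
  #-mono P⊆Q = ∑-mono (allFin n) (λ v → ⟦⟧-mono (P? v) (Q? v) (P⊆Q v))

  #-cong : (∀ v → P v → Q v) → (∀ v → Q v → P v) → # P? ≡ # Q?
  #-cong P⊆Q Q⊆P = ∑-cong (allFin n) (λ v → ⟦⟧-cong (P? v) (Q? v) (P⊆Q v) (Q⊆P v))

  #-< : # P? < # Q? → ∃[ v ] Q v × ¬ P v
  #-< lt with v , l ← ∑-< (allFin n) _ _ lt =
    v , ⟦⟧-pos (Q? v) (≤-<-trans z≤n l) ,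
    λ p → <⇒≱ l (subst (⟦ Q? v ⟧ ≤_) (sym (⟦⟧-true (P? v) p)) (⟦⟧≤1 (Q? v)))

  module _ {R : Pred (Fin n) 0ℓ} (R? : Decidable R) where

    #-cover : (∀ v → P v → Q v ⊎ R v) → # P? ≤ # Q? + # R?
    #-cover f = ≤-trans (∑-mono (allFin n) (λ v → ⟦⟧-cover (P? v) (Q? v) (R? v) (f v)))
                        (≤-reflexive (∑-+ (allFin n) _ _))

    #-disjoint : (∀ v → P v → R v) → (∀ v → Q v → R v) → (∀ v → P v → ¬ Q v) → # P? + # Q? ≤ # R?
    #-disjoint f g h = ≤-trans (≤-reflexive (sym (∑-+ (allFin n) _ _)))
      (∑-mono (allFin n) (λ v → ⟦⟧-disjoint (P? v) (Q? v) (R? v) (f v) (g v) (h v)))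

#-pos : {P : Pred (Fin n) 0ℓ} (P? : Decidable P) → 0 < # P? → ∃[ v ] P v
#-pos {n} P? lt with v , l ← ∑-< (allFin n) (λ _ → 0) _ (≤-<-trans (≤-reflexive (∑-zero (allFin n))) lt) =
  v , ⟦⟧-pos (P? v) l

#-all : {P : Pred (Fin n) 0ℓ} (P? : Decidable P) → (∀ v → P v) → # P? ≡ n
#-all {zero}  P? all = refl
#-all {suc n} P? all = trans (∑-allFin-suc {n} (λ v → ⟦ P? v ⟧))
  (cong₂ _+_ (⟦⟧-true (P? zero) (all zero)) (#-all (P? ∘ suc) (all ∘ suc)))

#-none : {P : Pred (Fin n) 0ℓ} (P? : Decidable P) → (∀ v → ¬ P v) → # P? ≡ 0
#-none {zero}  P? none = refl
#-none {suc n} P? none = trans (∑-allFin-suc {n} (λ v → ⟦ P? v ⟧))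
  (cong₂ _+_ (⟦⟧-false (P? zero) (none zero)) (#-none (P? ∘ suc) (none ∘ suc)))

#-singleton : (u : Fin n) → # (_≟ u) ≡ 1
#-singleton {suc n} zero = trans (∑-allFin-suc {n} (λ v → ⟦ v ≟ zero ⟧))
  (cong suc (#-none {n} (λ v → suc v ≟ zero) (λ v ())))
#-singleton {suc n} (suc u) = trans (∑-allFin-suc {n} (λ v → ⟦ v ≟ suc u ⟧))
  (trans (#-cong {n} (λ v → suc v ≟ suc u) (_≟ u) (λ { v refl → refl }) (λ { v refl → refl }))
    (#-singleton u))

#-complement : {P : Fin n → Set} (P? : ∀ v → Dec (P v)) → # (¬? ∘ P?) + # P? ≡ n
#-complement {n} {P} P? = ≤-antisym
  (≤-trans (#-disjoint (¬? ∘ P?) P? ⊤? _ _ (λ _ ¬p p → ¬p p)) (≤-reflexive #⊤≡n))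
  (≤-trans (≤-reflexive (sym #⊤≡n)) (#-cover ⊤? (¬? ∘ P?) P? cases))
  where
  ⊤? : (v : Fin n) → Dec Unit.⊤
  ⊤? _ = yes _
  #⊤≡n : # ⊤? ≡ n
  #⊤≡n = #-all ⊤? _
  cases : ∀ v → Unit.⊤ → ¬ P v ⊎ P v
  cases v _ with P? v
  ... | yes p = inj₂ p
  ... | no ¬p = inj₁ ¬p

-- The number of cliques

nC0≡1 : ∀ n → n C 0 ≡ 1
nC0≡1 n = trans (nCk≡nC[n∸k] {0} {n} z≤n) (nCn≡1 n)

C-monoˡ-≤ : ∀ k {m n} → m ≤ n → m C k ≤ n C k
C-monoˡ-≤ k m≤n = go (≤⇒≤′ m≤n)
  where
  step : ∀ k n → n C k ≤ suc n C k
  step zero    n = ≤-reflexive (trans (nC0≡1 n) (sym (nC0≡1 (suc n))))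
  step (suc k) n = ≤-trans (m≤n+m _ (n C k)) (≤-reflexive (nCk+nC[k+1]≡[n+1]C[k+1] n k))
  go : ∀ {m n} → m ≤′ n → m C k ≤ n C k
  go ≤′-refl     = ≤-refl
  go (≤′-step p) = ≤-trans (go p) (step k _)

subset : {P : Pred (Fin n) 0ℓ} → Decidable P → Subset n
subset P? = Vec.tabulate (λ v → does (P? v))

module _ {P : Pred (Fin n) 0ℓ} (P? : Decidable P) where

  ∈-subset⁺ : ∀ {v} → P v → v ∈ subset P?
  ∈-subset⁺ {v} p with P? v in eq
  ... | yes _ = Vec.lookup⇒[]= v _ (trans (Vec.lookup∘tabulate _ v) (cong does eq))
  ... | no ¬p = contradiction p ¬p

  ∈-subset⁻ : ∀ {v} → v ∈ subset P? → P v
  ∈-subset⁻ {v} v∈ with P? v in eq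
  ... | yes p = p
  ... | no _ with () ← trans (sym (cong does eq)) (trans (sym (Vec.lookup∘tabulate _ v)) (Vec.[]=⇒lookup v∈))

∣∷∣ : (b : Bool) (p : Subset n) → ∣ b ∷ p ∣ ≡ (if b then 1 else 0) + ∣ p ∣
∣∷∣ true  p = refl
∣∷∣ false p = refl

∣subset∣ : {P : Pred (Fin n) 0ℓ} (P? : Decidable P) → ∣ subset P? ∣ ≡ # P?
∣subset∣ {zero}  P? = refl
∣subset∣ {suc n} P? = trans (∣∷∣ (does (P? zero)) (subset (P? ∘ suc)))
  (trans (cong (⟦ P? zero ⟧ +_) (∣subset∣ (P? ∘ suc))) (sym (∑-allFin-suc {n} (λ v → ⟦ P? v ⟧))))

#∈ : (p : Subset n) → # (_∈? p) ≡ ∣ p ∣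
#∈ [] = refl
#∈ {suc n} (b ∷ p) = trans (∑-allFin-suc {n} (λ v → ⟦ v ∈? b ∷ p ⟧)) (trans (cong₂ _+_ (first b)
  (trans (#-cong {n} (λ v → suc v ∈? b ∷ p) (_∈? p) (λ _ → drop-there) (λ _ → there)) (#∈ p))) (sym (∣∷∣ b p)))
  where
  first : ∀ b → ⟦ zero ∈? b ∷ p ⟧ ≡ (if b then 1 else 0)
  first true  = refl
  first false = refl

∑-subsets : (f : Subset (suc n) → ℕ) →
            ∑ (subsets (suc n)) f ≡ ∑ (subsets n) (f ∘ (inside ∷_)) + ∑ (subsets n) (f ∘ (outside ∷_))
∑-subsets {n} f = trans (∑-++ (map (inside ∷_) (subsets n)) _ f)
  (cong₂ _+_ (∑-map (inside ∷_) (subsets n) f) (∑-map (outside ∷_) (subsets n) f))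

-- Splitting the subsets by membership of the first element reproduces Pascal's rule. If that
-- element is not in T, the first half contributes nothing.
∑-subsets-of-size : (T : Subset n) (k : ℕ) →
                    ∑ (subsets n) (λ S → ⟦ (S ⊆? T) ×-dec (∣ S ∣ ℕ.≟ k) ⟧) ≡ ∣ T ∣ C k
∑-subsets-of-size [] zero    = refl
∑-subsets-of-size [] (suc k) = refl
∑-subsets-of-size {suc n} (t ∷ T) k = begin
  ∑ (subsets (suc n)) (λ S → ⟦ size S ⟧)  ≡⟨ ∑-subsets (λ S → ⟦ size S ⟧) ⟩
  ∑ (subsets n) (λ S → ⟦ size (inside ∷ S) ⟧) + ∑ (subsets n) (λ S → ⟦ size (outside ∷ S) ⟧)
    ≡⟨ cong (∑ (subsets n) (λ S → ⟦ size (inside ∷ S) ⟧) +_) (trans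
         (∑-cong (subsets n) (λ S → ⟦⟧-cong (size (outside ∷ S)) ((S ⊆? T) ×-dec (∣ S ∣ ℕ.≟ k))
           (λ (s , e) → drop-∷-⊆ s , e) (λ (s , e) → out⊆ s , e)))
         (∑-subsets-of-size T k)) ⟩
  ∑ (subsets n) (λ S → ⟦ size (inside ∷ S) ⟧) + ∣ T ∣ C k ≡⟨ pascal t k ⟩
  ∣ t ∷ T ∣ C k ∎
  where
  open ≡-Reasoning
  size : (S : Subset (suc n)) → Dec (S ⊆ t ∷ T × ∣ S ∣ ≡ k)
  size S = (S ⊆? t ∷ T) ×-dec (∣ S ∣ ℕ.≟ k)
  pascal : ∀ t k → ∑ (subsets n) (λ S → ⟦ (inside ∷ S ⊆? t ∷ T) ×-dec (suc ∣ S ∣ ℕ.≟ k) ⟧) + ∣ T ∣ C k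
              ≡ ∣ t ∷ T ∣ C k
  pascal outside k = cong (_+ ∣ T ∣ C k) (trans
    (∑-cong (subsets n) (λ S → ⟦⟧-false ((inside ∷ S ⊆? outside ∷ T) ×-dec (suc ∣ S ∣ ℕ.≟ k))
      (λ (s , _) → contradiction (s here) λ ())))
    (∑-zero (subsets n)))
  pascal inside zero = trans (cong (_+ ∣ T ∣ C 0) (trans
    (∑-cong (subsets n) (λ S → ⟦⟧-false ((inside ∷ S ⊆? inside ∷ T) ×-dec (suc ∣ S ∣ ℕ.≟ 0)) λ ()))
    (∑-zero (subsets n)))) (trans (nC0≡1 ∣ T ∣) (sym (nC0≡1 (suc ∣ T ∣))))
  pascal inside (suc k) = trans (cong (_+ ∣ T ∣ C suc k) (trans
    (∑-cong (subsets n) (λ S → ⟦⟧-cong ((inside ∷ S ⊆? inside ∷ T) ×-dec (suc ∣ S ∣ ℕ.≟ suc k))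
       ((S ⊆? T) ×-dec (∣ S ∣ ℕ.≟ k))
       (λ (s , e) → drop-∷-⊆ s , suc-injective e) (λ (s , e) → in⊆in s , cong suc e)))
    (∑-subsets-of-size T k))) (nCk+nC[k+1]≡[n+1]C[k+1] ∣ T ∣ k)

-- Removing v is injective on the sets that contain v, so the non-zero terms of f are bounded by
-- distinct terms of g. This trades the cliques through v for subsets of its neighbourhood.
∑-delete : (v : Fin n) (f g : Subset n → ℕ) →
           (∀ S → v ∈ S → f S ≤ g (S - v)) → (∀ S → v ∉ S → f S ≡ 0) →
           ∑ (subsets n) f ≤ ∑ (subsets n) g
∑-delete {suc n} zero f g f≤g f≡0 = begin
  ∑ (subsets (suc n)) f ≡⟨ ∑-subsets f ⟩
  ∑ (subsets n) (f ∘ (inside ∷_)) + ∑ (subsets n) (f ∘ (outside ∷_))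
    ≤⟨ +-mono-≤ (∑-mono (subsets n) (λ S → ≤-trans (f≤g _ here)
         (≤-reflexive (cong (g ∘ (outside ∷_)) (p─⊥≡p S)))))
                (≤-reflexive (trans (∑-cong (subsets n) (λ S → f≡0 _ λ ())) (∑-zero (subsets n)))) ⟩
  ∑ (subsets n) (g ∘ (outside ∷_)) + 0 ≡⟨ +-identityʳ _ ⟩
  ∑ (subsets n) (g ∘ (outside ∷_)) ≤⟨ m≤n+m _ _ ⟩
  ∑ (subsets n) (g ∘ (inside ∷_)) + ∑ (subsets n) (g ∘ (outside ∷_)) ≡⟨ ∑-subsets g ⟨
  ∑ (subsets (suc n)) g ∎
  where open ≤-Reasoning
∑-delete {suc n} (suc v) f g f≤g f≡0 = begin
  ∑ (subsets (suc n)) f ≡⟨ ∑-subsets f ⟩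
  ∑ (subsets n) (f ∘ (inside ∷_)) + ∑ (subsets n) (f ∘ (outside ∷_))
    ≤⟨ +-mono-≤ (half inside) (half outside) ⟩
  ∑ (subsets n) (g ∘ (inside ∷_)) + ∑ (subsets n) (g ∘ (outside ∷_)) ≡⟨ ∑-subsets g ⟨
  ∑ (subsets (suc n)) g ∎
  where
  open ≤-Reasoning
  half : ∀ s → ∑ (subsets n) (f ∘ (s ∷_)) ≤ ∑ (subsets n) (g ∘ (s ∷_))
  half s = ∑-delete v _ _ (λ S v∈S → f≤g (s ∷ S) (there v∈S)) (λ S v∉S → f≡0 (s ∷ S) (v∉S ∘ drop-there))

∣p-x∣ : {p : Subset n} {x : Fin n} → x ∈ p → suc ∣ p - x ∣ ≡ ∣ p ∣
∣p-x∣ {p = _ ∷ p} here = cong suc (cong ∣_∣ (p─⊥≡p p))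
∣p-x∣ {p = inside  ∷ p} (there x∈p) = cong suc (∣p-x∣ x∈p)
∣p-x∣ {p = outside ∷ p} (there x∈p) = ∣p-x∣ x∈p

x∉p-x : (p : Subset n) (x : Fin n) → x ∉ p - x
x∉p-x (_ ∷ p) zero    ()
x∉p-x (_ ∷ p) (suc x) (there x∈) = x∉p-x p x x∈

degree≡# : (G : Graph n) (v : Fin n) → degree G v ≡ # (adj? G v)
degree≡# {n} G v = length-filter-∑ (adj? G v) (allFin n)

-- The vertices of `ds` are removed one by one. A clique in T that avoids v lies in T - v; one that
-- contains v is determined by s vertices of the neighbourhood of v, which leaves at most `j C s`
-- choices. After the last removal all subsets of the right size are counted.
cliqueCount-≤ : (G : Graph n) (s j : ℕ) (ds : List (Fin n)) (T : Subset n) →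
  Unique ds → All (_∈ T) ds → All (λ v → degree G v ≤ j) ds →
  ∑ (subsets n) (λ S → ⟦ (S ⊆? T) ×-dec ((∣ S ∣ ℕ.≟ suc s) ×-dec isClique? G S) ⟧)
    ≤ (∣ T ∣ ∸ length ds) C suc s + length ds * (j C s)
cliqueCount-≤ {n} G s j [] T _ _ _ = ≤-trans
  (∑-mono (subsets n) (λ S → ⟦⟧-mono ((S ⊆? T) ×-dec ((∣ S ∣ ℕ.≟ suc s) ×-dec isClique? G S))
    ((S ⊆? T) ×-dec (∣ S ∣ ℕ.≟ suc s)) (map₂ proj₁)))
  (≤-trans (≤-reflexive (∑-subsets-of-size T (suc s))) (m≤m+n _ 0))
cliqueCount-≤ {n} G s j (v ∷ ds) T (v∉ds ∷ uniq) (v∈T ∷ ds⊆T) (deg-v ∷ degs) = begin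
  ∑ (subsets n) (λ S → ⟦ inT S ⟧)
    ≤⟨ ∑-mono (subsets n) (λ S → ⟦⟧-cover (inT S) (inT-v S) (atV S) (split S)) ⟩
  ∑ (subsets n) (λ S → ⟦ inT-v S ⟧ + ⟦ atV S ⟧)
    ≡⟨ ∑-+ (subsets n) _ _ ⟩
  ∑ (subsets n) (λ S → ⟦ inT-v S ⟧) + ∑ (subsets n) (λ S → ⟦ atV S ⟧)
    ≤⟨ +-mono-≤ (cliqueCount-≤ G s j ds (T - v) uniq ds⊆T-v degs)
         (∑-delete v _ (λ S → ⟦ (S ⊆? N) ×-dec (∣ S ∣ ℕ.≟ s) ⟧)
           (λ S v∈S → ⟦⟧-mono (atV S) ((S - v ⊆? N) ×-dec (∣ S - v ∣ ℕ.≟ s)) (link S))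
           (λ S v∉S → ⟦⟧-false (atV S) (v∉S ∘ proj₁))) ⟩
  ((∣ T - v ∣ ∸ length ds) C suc s + length ds * (j C s))
    + ∑ (subsets n) (λ S → ⟦ (S ⊆? N) ×-dec (∣ S ∣ ℕ.≟ s) ⟧)
    ≤⟨ +-monoʳ-≤ _ (≤-trans (≤-reflexive (∑-subsets-of-size N s))
         (C-monoˡ-≤ s (≤-trans (≤-reflexive (trans (∣subset∣ (adj? G v)) (sym (degree≡# G v)))) deg-v))) ⟩
  ((∣ T - v ∣ ∸ length ds) C suc s + length ds * (j C s)) + j C s
    ≡⟨ +-assoc ((∣ T - v ∣ ∸ length ds) C suc s) _ _ ⟩
  (∣ T - v ∣ ∸ length ds) C suc s + (length ds * (j C s) + j C s)
    ≡⟨ cong₂ (λ a b → (a ∸ suc (length ds)) C suc s + b) (∣p-x∣ v∈T) (+-comm _ (j C s)) ⟩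
  (∣ T ∣ ∸ suc (length ds)) C suc s + (j C s + length ds * (j C s)) ∎
  where
  open ≤-Reasoning
  N = subset (adj? G v)
  Clique : Subset n → Set
  Clique S = ∣ S ∣ ≡ suc s × IsClique G S
  inT : ∀ S → Dec (S ⊆ T × Clique S)
  inT S = (S ⊆? T) ×-dec ((∣ S ∣ ℕ.≟ suc s) ×-dec isClique? G S)
  inT-v : ∀ S → Dec (S ⊆ T - v × Clique S)
  inT-v S = (S ⊆? T - v) ×-dec ((∣ S ∣ ℕ.≟ suc s) ×-dec isClique? G S)
  atV : ∀ S → Dec (v ∈ S × Clique S)
  atV S = (v ∈? S) ×-dec ((∣ S ∣ ℕ.≟ suc s) ×-dec isClique? G S)
  split : ∀ S → S ⊆ T × Clique S → (S ⊆ T - v × Clique S) ⊎ (v ∈ S × Clique S)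
  split S (S⊆T , c) with v ∈? S
  ... | yes v∈S = inj₂ (v∈S , c)
  ... | no  v∉S = inj₁ ((λ x∈S → x∈p∧x≢y⇒x∈p-y (S⊆T x∈S) (λ { refl → v∉S x∈S })) , c)
  link : ∀ S → v ∈ S × Clique S → S - v ⊆ N × ∣ S - v ∣ ≡ s
  link S (v∈S , size , clique) =
    (λ {x} x∈ → ∈-subset⁺ (adj? G v) (clique v x v∈S (p─q⊆p S _ x∈) (λ { refl → x∉p-x S v x∈ }))) ,
    suc-injective (trans (∣p-x∣ v∈S) size)
  ds⊆T-v : All (_∈ T - v) ds
  ds⊆T-v = All.zipWith (λ (x∈T , v≢x) → x∈p∧x≢y⇒x∈p-y x∈T (v≢x ∘ sym)) (ds⊆T , v∉ds)

-- Convexity of h_r in its degree parameter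

Convex : (ℕ → ℕ) → Set
Convex f = ∀ i → f (1 + i) + f (1 + i) ≤ f i + f (2 + i)

module _ {f : ℕ → ℕ} (convex : Convex f) where

  convex-increasing : f 0 ≤ f 1 → ∀ i → f i ≤ f (1 + i)
  convex-increasing f0≤f1 zero    = f0≤f1
  convex-increasing f0≤f1 (suc i) = +-cancelˡ-≤ (f (suc i)) _ _
    (≤-trans (convex i) (+-monoˡ-≤ _ (convex-increasing f0≤f1 i)))

  convex-mono : f 0 ≤ f 1 → ∀ k → f 1 ≤ f (suc k)
  convex-mono f0≤f1 zero    = ≤-refl
  convex-mono f0≤f1 (suc k) = ≤-trans (convex-mono f0≤f1 k) (convex-increasing f0≤f1 (suc k))

-- Induction that moves the left end: if f 1 ≤ f 0, the old end is at least as good as the new one;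
-- otherwise f increases from there on, and the right end dominates.
convex-≤-ends : {f : ℕ → ℕ} → Convex f → ∀ {i k} → i ≤ k → f i ≤ f 0 ⊔ f k
convex-≤-ends convex z≤n = m≤m⊔n _ _
convex-≤-ends {f} convex {suc i} {suc k} (s≤s i≤k)
  with ≤-total (f 1) (f 0) | convex-≤-ends {f ∘ suc} (convex ∘ suc) i≤k
... | inj₁ f1≤f0 | ih = ≤-trans ih (⊔-monoˡ-≤ (f (suc k)) f1≤f0)
... | inj₂ f0≤f1 | ih = ≤-trans ih
  (≤-trans (⊔-lub (convex-mono {f} convex f0≤f1 k) ≤-refl) (m≤n⊔m (f 0) (f (suc k))))

-- By Pascal's rule the differences of `_C suc k` are the values of `_C k`, which increase.
C-convex : ∀ k → Convex (_C k)
C-convex zero    i = ≤-reflexive (cong₂ _+_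
  (trans (nC0≡1 (1 + i)) (sym (nC0≡1 i))) (trans (nC0≡1 (1 + i)) (sym (nC0≡1 (2 + i)))))
C-convex (suc k) i = begin
  (1 + i) C suc k + (1 + i) C suc k           ≡⟨ cong (_+ (1 + i) C suc k) (nCk+nC[k+1]≡[n+1]C[k+1] i k) ⟨
  (i C k + i C suc k) + (1 + i) C suc k       ≡⟨ cong (_+ (1 + i) C suc k) (+-comm (i C k) _) ⟩
  (i C suc k + i C k) + (1 + i) C suc k       ≡⟨ +-assoc (i C suc k) _ _ ⟩
  i C suc k + (i C k + (1 + i) C suc k)       ≤⟨ +-monoʳ-≤ (i C suc k) (+-monoˡ-≤ _ (C-monoˡ-≤ k (n≤1+n i))) ⟩
  i C suc k + ((1 + i) C k + (1 + i) C suc k) ≡⟨ cong (i C suc k +_) (nCk+nC[k+1]≡[n+1]C[k+1] (1 + i) k) ⟩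
  i C suc k + (2 + i) C suc k                 ∎
  where open ≤-Reasoning

-- Truncation does no harm: the sequence decreases to `0 C suc k`, which is 0, and then stays there.
C-∸-convex : ∀ N k → Convex (λ i → (N ∸ i) C suc k)
C-∸-convex N k i
  rewrite sym (pred[m∸n]≡m∸[1+n] N (suc i)) | sym (pred[m∸n]≡m∸[1+n] N i) = go (N ∸ i)
  where
  go : ∀ x → pred x C suc k + pred x C suc k ≤ x C suc k + pred (pred x) C suc k
  go 0 = ≤-refl
  go 1 = m≤n+m _ _
  go (suc (suc x)) = ≤-trans (C-convex (suc k) x) (≤-reflexive (+-comm (x C suc k) _))

-- The second difference of the product is k + i times that of f, plus twice the increment f (2 + i)
-- - f (1 + i).
*-convex : {f : ℕ → ℕ} → Convex f → (∀ i → f i ≤ f (1 + i)) → ∀ k → Convex (λ i → (k + i) * f i)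
*-convex {f} convex mono k i
  rewrite +-suc k (suc i) | +-suc k i = begin
  (1 + x) * f (1 + i) + (1 + x) * f (1 + i)           ≡⟨ expand x (f (1 + i)) ⟩
  x * (f (1 + i) + f (1 + i)) + 2 * f (1 + i)
    ≤⟨ +-mono-≤ (*-monoʳ-≤ x (convex i)) (*-monoʳ-≤ 2 (mono (1 + i))) ⟩
  x * (f i + f (2 + i)) + 2 * f (2 + i)               ≡⟨ collect x (f i) (f (2 + i)) ⟩
  x * f i + (2 + x) * f (2 + i)                       ∎
  where
  open ≤-Reasoning
  x = k + i
  expand : ∀ x a → (1 + x) * a + (1 + x) * a ≡ x * (a + a) + 2 * a
  expand = solve-∀
  collect : ∀ x a b → x * (a + b) + 2 * b ≡ x * a + (2 + x) * b
  collect = solve-∀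

+-convex : {f g : ℕ → ℕ} → Convex f → Convex g → Convex (λ i → f i + g i)
+-convex {f} {g} cf cg i = begin
  (f (1 + i) + g (1 + i)) + (f (1 + i) + g (1 + i)) ≡⟨ interchange (f (1 + i)) _ _ _ ⟩
  (f (1 + i) + f (1 + i)) + (g (1 + i) + g (1 + i)) ≤⟨ +-mono-≤ (cf i) (cg i) ⟩
  (f i + f (2 + i)) + (g i + g (2 + i))             ≡⟨ interchange (f i) _ _ _ ⟩
  (f i + g i) + (f (2 + i) + g (2 + i))             ∎
  where open ≤-Reasoning

module _ (s n ℓ b : ℕ) (ℓ≤b : ℓ ≤ b) where

  -- h_{s+1}(n, b + i, ℓ), extended to a convex function of all i
  shifted-h : ℕ → ℕ
  shifted-h i = ((n ∸ b + ℓ) ∸ i) C suc s + ((b ∸ ℓ) + i) * ((b + i) C s)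

  shifted-h-convex : Convex shifted-h
  shifted-h-convex = +-convex {λ i → ((n ∸ b + ℓ) ∸ i) C suc s} {λ i → ((b ∸ ℓ) + i) * ((b + i) C s)}
    (C-∸-convex (n ∸ b + ℓ) s)
    (*-convex {λ i → (b + i) C s} (λ i → shift i)
      (λ i → C-monoˡ-≤ s (+-monoʳ-≤ b (n≤1+n i))) (b ∸ ℓ))
    where
    shift : Convex (λ i → (b + i) C s)
    shift i rewrite +-suc b (suc i) | +-suc b i = C-convex s (b + i)

  h≡shifted-h : ∀ i → b + i ≤ n → h (suc s) n (b + i) ℓ ≡ shifted-h i
  h≡shifted-h i b+i≤n = cong₂ (λ x y → x C suc s + y * ((b + i) C s))
    (trans (cong (_+ ℓ) (sym (∸-+-assoc n b i)))
           (sym (+-∸-comm ℓ (≤-trans (≤-reflexive (sym (m+n∸m≡n b i))) (∸-monoˡ-≤ b b+i≤n)))))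
    (+-∸-comm i ℓ≤b)

  -- With b = d + 1 this reduces every degree j in question to the two values that the hypothesis on
  -- N(G, K_r) controls.
  h-≤-ends : ∀ {j m} → b ≤ j → j ≤ m → m ≤ n → h (suc s) n j ℓ ≤ h (suc s) n b ℓ ⊔ h (suc s) n m ℓ
  h-≤-ends {j} {m} b≤j j≤m m≤n = subst₂ (λ x y → h (suc s) n x ℓ ≤ h (suc s) n b ℓ ⊔ h (suc s) n y ℓ)
    (m+[n∸m]≡n b≤j) (m+[n∸m]≡n (≤-trans b≤j j≤m))
    (subst₂ _≤_ (sym (h≡shifted-h i (bound b≤j (≤-trans j≤m m≤n))))
      (sym (cong₂ _⊔_ (trans (cong (λ x → h (suc s) n x ℓ) (sym (+-identityʳ b)))
                        (h≡shifted-h 0 (≤-trans (≤-reflexive (+-identityʳ b)) (≤-trans b≤j (≤-trans j≤m m≤n)))))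
                      (h≡shifted-h k (bound (≤-trans b≤j j≤m) m≤n))))
      (convex-≤-ends {shifted-h} shifted-h-convex (∸-monoˡ-≤ b j≤m)))
    where
    i = j ∸ b
    k = m ∸ b
    bound : ∀ {x} → b ≤ x → x ≤ n → b + (x ∸ b) ≤ n
    bound b≤x x≤n = ≤-trans (≤-reflexive (m+[n∸m]≡n b≤x)) x≤n

-- Few vertices of low degree

low? : (G : Graph n) (j : ℕ) (v : Fin n) → Dec (degree G v ≤ j)
low? G j v = degree G v ≤? j

n∸[j∸ℓ] : ∀ {n j ℓ} → ℓ ≤ j → j ≤ n → n ∸ (j ∸ ℓ) ≡ n ∸ j + ℓ
n∸[j∸ℓ] {n} {j} {ℓ} ℓ≤j j≤n = begin
  n ∸ (j ∸ ℓ)             ≡⟨ cong (_∸ (j ∸ ℓ)) (m∸n+n≡m j≤n) ⟨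
  ((n ∸ j) + j) ∸ (j ∸ ℓ)   ≡⟨ +-∸-assoc (n ∸ j) (m∸n≤m j ℓ) ⟩
  (n ∸ j) + (j ∸ (j ∸ ℓ))   ≡⟨ cong (n ∸ j +_) (m∸[m∸n]≡n ℓ≤j) ⟩
  n ∸ j + ℓ               ∎
  where open ≡-Reasoning

cliqueCount-≤-h : (G : Graph n) (s j ℓ : ℕ) → ℓ ≤ j → j ≤ n → j ≤ # (low? G j) + ℓ →
                  cliqueCount G (suc s) ≤ h (suc s) n j ℓ
cliqueCount-≤-h {n} G s j ℓ ℓ≤j j≤n many = begin
  cliqueCount G (suc s)
    ≡⟨ length-filter-∑ (λ S → (∣ S ∣ ℕ.≟ suc s) ×-dec isClique? G S) (subsets n) ⟩
  ∑ (subsets n) (λ S → ⟦ (∣ S ∣ ℕ.≟ suc s) ×-dec isClique? G S ⟧)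
    ≤⟨ ∑-mono (subsets n) (λ S → ⟦⟧-mono ((∣ S ∣ ℕ.≟ suc s) ×-dec isClique? G S)
         ((S ⊆? ⊤) ×-dec ((∣ S ∣ ℕ.≟ suc s) ×-dec isClique? G S)) ((λ _ → ∈⊤) ,_)) ⟩
  ∑ (subsets n) (λ S → ⟦ (S ⊆? ⊤) ×-dec ((∣ S ∣ ℕ.≟ suc s) ×-dec isClique? G S) ⟧)
    ≤⟨ cliqueCount-≤ G s j ds ⊤ (Unique.take⁺ (j ∸ ℓ) (Unique.filter⁺ (low? G j) (Unique.allFin⁺ n)))
         (All.universal (λ _ → ∈⊤) ds) (All.take⁺ (j ∸ ℓ) (All.all-filter (low? G j) (allFin n))) ⟩
  (∣ ⊤ {n} ∣ ∸ length ds) C suc s + length ds * (j C s)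
    ≡⟨ cong₂ (λ a b → (a ∸ b) C suc s + b * (j C s)) (∣⊤∣≡n n) length-ds ⟩
  (n ∸ (j ∸ ℓ)) C suc s + (j ∸ ℓ) * (j C s)
    ≡⟨ cong (λ a → a C suc s + (j ∸ ℓ) * (j C s)) (n∸[j∸ℓ] ℓ≤j j≤n) ⟩
  h (suc s) n j ℓ ∎
  where
  open ≤-Reasoning
  -- Of the low vertices exactly j ∸ ℓ are removed, so that both terms of the bound become those of
  -- `h`; `many` provides that number.
  ds = take (j ∸ ℓ) (filter (low? G j) (allFin n))
  length-ds : length ds ≡ j ∸ ℓ
  length-ds = trans (length-take (j ∸ ℓ) (filter (low? G j) (allFin n)))
    (m≤n⇒m⊓n≡m (≤-trans (∸-monoˡ-≤ ℓ many)
      (≤-reflexive (trans (m+n∸n≡m (# (low? G j)) ℓ) (sym (length-filter-∑ (low? G j) (allFin n)))))))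

-- The only consequence of the bound on N(G, K_r) that is used. It survives adding edges to G.
FewLow : (d ℓ m : ℕ) → Graph n → Set
FewLow d ℓ m G = ∀ j → j ≤ m → d < j ⊎ j ≡ m → # (low? G j) + ℓ < j

-- A failure at j would bound the number of cliques by h_r(n, j, ℓ), hence by convexity by the
-- maximum that it exceeds.
fewLow : ∀ (G : Graph n) s d ℓ m → ℓ < d → d ≤ m → m ≤ n →
         cliqueCount G (suc s) > h (suc s) n (d + 1) ℓ ⊔ h (suc s) n m ℓ → FewLow d ℓ m G
fewLow {n} G s d ℓ m ℓ<d d≤m m≤n many j j≤m d<j⊎j≡m = ≰⇒> λ j≤low →
  <⇒≱ many (≤-trans (cliqueCount-≤-h G s j ℓ (ℓ≤j d<j⊎j≡m) (≤-trans j≤m m≤n) j≤low) (h-bound d<j⊎j≡m))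
  where
  ℓ≤j : d < j ⊎ j ≡ m → ℓ ≤ j
  ℓ≤j (inj₁ d<j)  = <⇒≤ (<-trans ℓ<d d<j)
  ℓ≤j (inj₂ refl) = <⇒≤ (<-≤-trans ℓ<d d≤m)
  h-bound : d < j ⊎ j ≡ m → h (suc s) n j ℓ ≤ h (suc s) n (d + 1) ℓ ⊔ h (suc s) n m ℓ
  h-bound (inj₁ d<j) = h-≤-ends s n ℓ (d + 1) (≤-trans (<⇒≤ ℓ<d) (m≤m+n d 1))
    (≤-trans (≤-reflexive (+-comm d 1)) d<j) j≤m m≤n
  h-bound (inj₂ refl) = m≤n⊔m (h (suc s) n (d + 1) ℓ) _

-- Paths

private
  variable
    V : Set
    a b c d u v : V

Same : V → V → V → V → Set
Same a b u v = (a ≡ u × b ≡ v) ⊎ (a ≡ v × b ≡ u)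

Same-sym : Same a b u v → Same a b v u
Same-sym = Sum.swap

Same-comm : Same a b u v → Same b a u v
Same-comm (inj₁ (x , y)) = inj₂ (y , x)
Same-comm (inj₂ (x , y)) = inj₁ (y , x)

Same-trans : ∀ {V : Set} {a b u v y z : V} → Same a b u v → Same a b y z → Same u v y z
Same-trans (inj₁ (refl , refl)) = id
Same-trans (inj₂ (refl , refl)) = Same-comm

infixr 5 _∷_ _⋈_

-- Non-empty vertex sequences, indexed by their first and last entries.
data Seg {V : Set} : V → V → Set where
  [_] : ∀ a → Seg a a
  _∷_ : ∀ a {b c} → Seg b c → Seg a c

verts : Seg {V} a b → List V
verts [ a ]   = a ∷ []
verts (a ∷ s) = a ∷ verts s

Edge : Seg {V} a b → V → V → Set
Edge [ _ ]           u v = ⊥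
Edge (_∷_ a {b} s) u v = Same a b u v ⊎ Edge s u v

_⋈_ : Seg {V} a b → Seg c d → Seg a d
[ a ]   ⋈ t = a ∷ t
(a ∷ s) ⋈ t = a ∷ (s ⋈ t)

rev : Seg {V} a b → Seg b a
rev [ a ]   = [ a ]
rev (a ∷ s) = rev s ⋈ [ a ]

verts-⋈ : (s : Seg {V} a b) (t : Seg c d) → verts (s ⋈ t) ≡ verts s ++ verts t
verts-⋈ [ a ]   t = refl
verts-⋈ (a ∷ s) t = cong (a ∷_) (verts-⋈ s t)

verts-⋈-comm : (s : Seg {V} a b) (t : Seg c d) → verts (s ⋈ t) ↭ verts (t ⋈ s)
verts-⋈-comm s t = ↭-trans (↭-reflexive (verts-⋈ s t))
  (↭-trans (Perm.++-comm (verts s) (verts t)) (↭-reflexive (sym (verts-⋈ t s))))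

verts-⋈-cong : {a b c d a′ b′ c′ d′ : V} {s : Seg a b} {t : Seg c d} {s′ : Seg a′ b′} {t′ : Seg c′ d′} →
               verts s ↭ verts s′ → verts t ↭ verts t′ → verts (s ⋈ t) ↭ verts (s′ ⋈ t′)
verts-⋈-cong {s = s} {t} {s′} {t′} p q = ↭-trans (↭-reflexive (verts-⋈ s t))
  (↭-trans (Perm.++⁺ p q) (↭-reflexive (sym (verts-⋈ s′ t′))))

verts-rev : (s : Seg {V} a b) → verts (rev s) ↭ verts s
verts-rev [ a ]   = ↭-refl
verts-rev (a ∷ s) = ↭-trans (verts-⋈-comm (rev s) [ a ]) (prep a (verts-rev s))

⋈-assoc : ∀ {V : Set} {a b c d e f : V} (r : Seg a b) (s : Seg c d) (t : Seg e f) → (r ⋈ s) ⋈ t ≡ r ⋈ (s ⋈ t)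
⋈-assoc [ a ]   s t = refl
⋈-assoc (a ∷ r) s t = cong (a ∷_) (⋈-assoc r s t)

first∈ : (s : Seg {V} a b) → a List.∈ verts s
first∈ [ a ]   = here refl
first∈ (a ∷ s) = here refl

last∈ : (s : Seg {V} a b) → b List.∈ verts s
last∈ [ a ]   = here refl
last∈ (a ∷ s) = there (last∈ s)

Edge-sym : (s : Seg {V} a b) → Edge s u v → Edge s v u
Edge-sym (a ∷ s) = Sum.map Same-sym (Edge-sym s)

Edge-∈ : (s : Seg {V} a b) → Edge s u v → u List.∈ verts s
Edge-∈ (a ∷ s) (inj₁ (inj₁ (refl , _))) = here refl
Edge-∈ (a ∷ s) (inj₁ (inj₂ (_ , refl))) = there (first∈ s)
Edge-∈ (a ∷ s) (inj₂ e)                 = there (Edge-∈ s e)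

Edge-⋈⁺ : (s : Seg {V} a b) (t : Seg c d) → Edge s u v ⊎ Same b c u v ⊎ Edge t u v → Edge (s ⋈ t) u v
Edge-⋈⁺ [ a ]       t (inj₂ e)        = e
Edge-⋈⁺ (a ∷ [ b ]) t (inj₁ (inj₁ e)) = inj₁ e
Edge-⋈⁺ (a ∷ b ∷ s) t (inj₁ (inj₁ e)) = inj₁ e
Edge-⋈⁺ (a ∷ s)     t (inj₁ (inj₂ e)) = inj₂ (Edge-⋈⁺ s t (inj₁ e))
Edge-⋈⁺ (a ∷ s)     t (inj₂ e)        = inj₂ (Edge-⋈⁺ s t (inj₂ e))

Edge-⋈⁻ : (s : Seg {V} a b) (t : Seg c d) → Edge (s ⋈ t) u v → Edge s u v ⊎ Same b c u v ⊎ Edge t u v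
Edge-⋈⁻ [ a ]       t e        = inj₂ e
Edge-⋈⁻ (a ∷ [ b ]) t (inj₁ e) = inj₁ (inj₁ e)
Edge-⋈⁻ (a ∷ b ∷ s) t (inj₁ e) = inj₁ (inj₁ e)
Edge-⋈⁻ (a ∷ s)     t (inj₂ e) = Sum.map₁ inj₂ (Edge-⋈⁻ s t e)

Edge-rev⁺ : (s : Seg {V} a b) → Edge s u v → Edge (rev s) u v
Edge-rev⁺ (a ∷ s) (inj₁ e) = Edge-⋈⁺ (rev s) [ a ] (inj₂ (inj₁ (Same-comm e)))
Edge-rev⁺ (a ∷ s) (inj₂ e) = Edge-⋈⁺ (rev s) [ a ] (inj₁ (Edge-rev⁺ s e))

Edge-rev⁻ : (s : Seg {V} a b) → Edge (rev s) u v → Edge s u v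
Edge-rev⁻ (a ∷ s) e with Edge-⋈⁻ (rev s) [ a ] e
... | inj₁ e′        = inj₂ (Edge-rev⁻ s e′)
... | inj₂ (inj₁ e′) = inj₁ (Same-comm e′)

Edge-irrefl : (s : Seg {V} a b) → Unique (verts s) → Edge s u v → u ≢ v
Edge-irrefl (a ∷ s) (a∉ ∷ _) (inj₁ (inj₁ (refl , refl))) = All.lookup a∉ (first∈ s)
Edge-irrefl (a ∷ s) (a∉ ∷ _) (inj₁ (inj₂ (refl , refl))) = All.lookup a∉ (first∈ s) ∘ sym
Edge-irrefl (a ∷ s) (_ ∷ uniq) (inj₂ e) = Edge-irrefl s uniq e

first≢last : (s : Seg {V} a b) → Unique (verts s) → 2 ≤ length (verts s) → a ≢ b
first≢last (a ∷ s) (a∉ ∷ _) _ = All.lookup a∉ (last∈ s)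
first≢last [ a ] _ (s≤s ())

-- The ends of a path are consecutive on it only if there are no further vertices. Thus an edge cut
-- out of a cycle does not recur on the remaining path.
¬Edge-ends : (s : Seg {V} a b) → Unique (verts s) → 3 ≤ length (verts s) → Edge s u v → ¬ Same a b u v
¬Edge-ends (a ∷ [ b ]) _ (s≤s (s≤s ()))
¬Edge-ends (a ∷ s@(b ∷ t)) (a∉ ∷ b∉ ∷ _) _ (inj₁ (inj₁ (refl , refl))) (inj₁ (_ , refl)) =
  All.lookup b∉ (last∈ t) refl
¬Edge-ends (a ∷ s@(b ∷ t)) (a∉ ∷ b∉ ∷ _) _ (inj₁ (inj₁ (refl , refl))) (inj₂ (refl , _)) =
  All.lookup a∉ (first∈ s) refl
¬Edge-ends (a ∷ s@(b ∷ t)) (a∉ ∷ b∉ ∷ _) _ (inj₁ (inj₂ (refl , refl))) (inj₂ (_ , refl)) =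
  All.lookup b∉ (last∈ t) refl
¬Edge-ends (a ∷ s@(b ∷ t)) (a∉ ∷ b∉ ∷ _) _ (inj₁ (inj₂ (refl , refl))) (inj₁ (refl , _)) =
  All.lookup a∉ (first∈ s) refl
¬Edge-ends (a ∷ s) (a∉ ∷ _) _ (inj₂ e) (inj₁ (refl , _)) = All.lookup a∉ (Edge-∈ s e) refl
¬Edge-ends (a ∷ s) (a∉ ∷ _) _ (inj₂ e) (inj₂ (refl , _)) = All.lookup a∉ (Edge-∈ s (Edge-sym s e)) refl

record Split {V : Set} {a b : V} (s : Seg a b) (Q : V → V → Set) : Set where
  constructor split
  field
    {p} {q} : V
    before  : Seg a p
    after   : Seg q b
    eq      : s ≡ before ⋈ after
    holds   : Q p q

-- Quantifying over decompositions rather than edges keeps the direction of each step and the place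
-- where a rerouting cuts the path.
AllSteps : {V : Set} {a b : V} → Seg a b → (V → V → Set) → Set
AllSteps {a = a} {b} s Q = ∀ {p q} (s₁ : Seg a p) (s₂ : Seg q b) → s ≡ s₁ ⋈ s₂ → Q p q

AllSteps-tail : {V : Set} {a b c : V} {Q : V → V → Set} {s : Seg b c} → AllSteps (a ∷ s) Q → AllSteps s Q
AllSteps-tail all s₁ s₂ eq = all (_ ∷ s₁) s₂ (cong (_ ∷_) eq)

findStep : {V : Set} {a b : V} {Q : V → V → Set} → (∀ p q → Dec (Q p q)) → (s : Seg a b) →
           Split s Q ⊎ AllSteps s (λ p q → ¬ Q p q)
findStep Q? [ a ] = inj₂ λ { [ _ ] _ () ; (_ ∷ _) _ () }
findStep {Q = Q} Q? (_∷_ a {b} s) with Q? a b | findStep Q? s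
... | yes Qab | _ = inj₁ (split [ a ] s refl Qab)
... | no ¬Qab | inj₁ (split s₁ s₂ eq Qpq) = inj₁ (split (a ∷ s₁) s₂ (cong (a ∷_) eq) Qpq)
... | no ¬Qab | inj₂ none = inj₂ λ { [ _ ] _ refl → ¬Qab ; (_ ∷ s₁) s₂ refl → none s₁ s₂ refl }

AllSteps-Edge : {V : Set} {a b u v : V} {Q : V → V → Set} → (∀ {p q} → Q p q → Q q p) →
                (s : Seg a b) → AllSteps s Q → Edge s u v → Q u v
AllSteps-Edge Q-sym (a ∷ s) all (inj₁ (inj₁ (refl , refl))) = all [ a ] s refl
AllSteps-Edge Q-sym (a ∷ s) all (inj₁ (inj₂ (refl , refl))) = Q-sym (all [ a ] s refl)
AllSteps-Edge {Q = Q} Q-sym (a ∷ s) all (inj₂ e) = AllSteps-Edge Q-sym s (AllSteps-tail {Q = Q} all) e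

splitAfter : (s : Seg {V} a b) → v List.∈ verts s → v ≢ b →
             ∃[ q ] Σ[ s₁ ∈ Seg a v ] Σ[ s₂ ∈ Seg q b ] s ≡ s₁ ⋈ s₂
splitAfter [ a ]   (here refl) v≢b = contradiction refl v≢b
splitAfter (a ∷ s) (here refl) v≢b = _ , [ a ] , s , refl
splitAfter (a ∷ s) (there v∈)  v≢b with _ , s₁ , s₂ , eq ← splitAfter s v∈ v≢b =
  _ , a ∷ s₁ , s₂ , cong (a ∷_) eq

splitBefore : (s : Seg {V} a b) → v List.∈ verts s →
              v ≡ a ⊎ ∃[ p ] Σ[ s₁ ∈ Seg a p ] Σ[ s₂ ∈ Seg v b ] s ≡ s₁ ⋈ s₂
splitBefore [ a ]   (here refl) = inj₁ refl
splitBefore (a ∷ s) (here refl) = inj₁ refl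
splitBefore (a ∷ s) (there v∈) with splitBefore s v∈
... | inj₁ refl               = inj₂ (_ , [ a ] , s , refl)
... | inj₂ (_ , s₁ , s₂ , eq) = inj₂ (_ , a ∷ s₁ , s₂ , cong (a ∷_) eq)

stepSum : {V : Set} {a b : V} → (V → V → ℕ) → Seg a b → ℕ
stepSum f [ _ ]           = 0
stepSum f (_∷_ a {b} s) = f a b + stepSum f s

stepSum-+ : {V : Set} {a b : V} (f g : V → V → ℕ) (s : Seg a b) →
            stepSum (λ p q → f p q + g p q) s ≡ stepSum f s + stepSum g s
stepSum-+ f g [ a ] = refl
stepSum-+ f g (_∷_ a {b} s) rewrite stepSum-+ f g s = interchange (f a b) _ _ _

stepSum-second : {V : Set} {a b : V} (f : V → ℕ) (s : Seg a b) → f a + stepSum (λ _ q → f q) s ≡ ∑ (verts s) f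
stepSum-second f [ a ]   = refl
stepSum-second f (a ∷ s) = cong (f a +_) (stepSum-second f s)

stepSum-first : {V : Set} {a b : V} (f : V → ℕ) (s : Seg a b) → stepSum (λ p _ → f p) s + f b ≡ ∑ (verts s) f
stepSum-first f [ a ]   = +-comm 0 (f a)
stepSum-first f (a ∷ s) = trans (+-assoc (f a) _ _) (cong (f a +_) (stepSum-first f s))

stepSum-1 : (s : Seg {V} a b) → suc (stepSum (λ _ _ → 1) s) ≡ length (verts s)
stepSum-1 [ a ]   = refl
stepSum-1 (a ∷ s) = cong suc (stepSum-1 s)

stepSum-mono : {V : Set} {a b : V} (f g : V → V → ℕ) (s : Seg a b) →
               AllSteps s (λ p q → f p q ≤ g p q) → stepSum f s ≤ stepSum g s
stepSum-mono f g [ a ]   _   = z≤n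
stepSum-mono f g (a ∷ s) f≤g =
  +-mono-≤ (f≤g [ a ] s refl) (stepSum-mono f g s (AllSteps-tail {Q = λ p q → f p q ≤ g p q} f≤g))

-- When the totals agree, a termwise inequality has no slack anywhere.
stepSum-tight : {V : Set} {a b : V} (f g : V → V → ℕ) (s : Seg a b) → AllSteps s (λ p q → f p q ≤ g p q) →
                stepSum g s ≤ stepSum f s → AllSteps s (λ p q → f p q ≡ g p q)
stepSum-tight f g _ f≤g le [ a ] s₂ refl = ≤-antisym (f≤g [ a ] s₂ refl)
  (+-cancelʳ-≤ (stepSum g s₂) _ _ (≤-trans le (+-monoʳ-≤ _
    (stepSum-mono f g s₂ (AllSteps-tail {Q = λ p q → f p q ≤ g p q} f≤g)))))
stepSum-tight f g _ f≤g le (a ∷ s₁) s₂ refl =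
  stepSum-tight f g (s₁ ⋈ s₂) (AllSteps-tail {Q = λ p q → f p q ≤ g p q} f≤g)
    (+-cancelˡ-≤ (g a _) _ _ (≤-trans le (+-monoˡ-≤ _ (f≤g [ a ] (s₁ ⋈ s₂) refl)))) s₁ s₂ refl

∑-pairs : List V → (V → V → ℕ) → ℕ
∑-pairs xs e = ∑ xs (λ u → ∑ xs (e u))

-- In the matrix of all pairs of positions, the first step is charged to the row and the column of
-- the first vertex, the later steps to the remaining submatrix.
stepSum-≤-∑-pairs : {V : Set} {a b : V} (e : V → V → ℕ) (s : Seg a b) →
                    stepSum (λ p q → e p q + e q p) s ≤ ∑-pairs (verts s) e
stepSum-≤-∑-pairs e [ a ] = z≤n
stepSum-≤-∑-pairs e (_∷_ a {b} s) = begin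
  (e a b + e b a) + stepSum (λ p q → e p q + e q p) s
    ≤⟨ +-mono-≤ (+-mono-≤ (∑-∈ (e a) (first∈ s)) (∑-∈ (λ u → e u a) (first∈ s))) (stepSum-≤-∑-pairs e s) ⟩
  (∑ (verts s) (e a) + ∑ (verts s) (λ u → e u a)) + ∑-pairs (verts s) e
    ≡⟨ +-assoc (∑ (verts s) (e a)) _ _ ⟩
  ∑ (verts s) (e a) + (∑ (verts s) (λ u → e u a) + ∑-pairs (verts s) e)
    ≡⟨ cong (∑ (verts s) (e a) +_) (∑-+ (verts s) _ _) ⟨
  ∑ (verts s) (e a) + ∑ (verts s) (λ u → ∑ (a ∷ verts s) (e u))
    ≤⟨ +-monoˡ-≤ _ (m≤n+m _ (e a a)) ⟩
  ∑-pairs (a ∷ verts s) e ∎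
  where open ≤-Reasoning

∑-pairs-↭ : {xs ys : List V} (e : V → V → ℕ) → xs ↭ ys → ∑-pairs xs e ≡ ∑-pairs ys e
∑-pairs-↭ {xs = xs} {ys} e p = trans (∑-cong xs (λ u → ∑-↭ (e u) p)) (∑-↭ (λ u → ∑ ys (e u)) p)

-- Segments and lists of vertices

fromList : (x : V) (xs : List V) → ∃[ b ] Σ[ s ∈ Seg x b ] verts s ≡ x ∷ xs
fromList x []       = x , [ x ] , refl
fromList x (y ∷ xs) with b , s , eq ← fromList y xs = b , x ∷ s , cong (x ∷_) eq

steps-∷ : (s : Seg {V} a b) → steps (c ∷ verts s) ≡ (c , a) ∷ steps (verts s)
steps-∷ [ a ]   = refl
steps-∷ (a ∷ s) = refl

Traverses⇒Edge : (s : Seg {V} a b) → Traverses (verts s) u v → Edge s u v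
Traverses⇒Edge s (inj₁ uv∈) = go s uv∈
  where
  go : (s : Seg {V} a b) → (u , v) List.∈ steps (verts s) → Edge s u v
  go (a ∷ s) uv∈ with subst (_ List.∈_) (steps-∷ s) uv∈
  ... | here refl = inj₁ (inj₁ (refl , refl))
  ... | there uv∈ = inj₂ (go s uv∈)
Traverses⇒Edge s (inj₂ vu∈) = Edge-sym s (Traverses⇒Edge s (inj₁ vu∈))

Edge⇒Traverses : (s : Seg {V} a b) → Edge s u v → Traverses (verts s) u v
Edge⇒Traverses (a ∷ s) e =
  Sum.map (subst (_ List.∈_) (sym (steps-∷ s))) (subst (_ List.∈_) (sym (steps-∷ s))) (go e)
  where
  go : Edge (a ∷ s) u v → (u , v) List.∈ (a , _) ∷ steps (verts s) ⊎ (v , u) List.∈ (a , _) ∷ steps (verts s)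
  go (inj₁ (inj₁ (refl , refl))) = inj₁ (here refl)
  go (inj₁ (inj₂ (refl , refl))) = inj₂ (here refl)
  go (inj₂ e) = Sum.map there there (Edge⇒Traverses s e)

Edge⊆⇒Linked : {V : Set} {a b : V} {R : V → V → Set} (s : Seg a b) →
                (∀ {u v} → Edge s u v → R u v) → Linked R (verts s)
Edge⊆⇒Linked [ a ] _ = [-]
Edge⊆⇒Linked (a ∷ [ b ])   Edge⊆R = Edge⊆R (inj₁ (inj₁ (refl , refl))) ∷ [-]
Edge⊆⇒Linked (a ∷ s@(_ ∷ _)) Edge⊆R = Edge⊆R (inj₁ (inj₁ (refl , refl))) ∷ Edge⊆⇒Linked s (Edge⊆R ∘ inj₂)

close-verts : (s : Seg {V} a b) → close (verts s) ≡ verts (s ⋈ [ a ])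
close-verts [ a ]   = refl
close-verts (a ∷ s) = cong (a ∷_) (sym (verts-⋈ s [ a ]))

∈-steps-∷ : ∀ {A : Set} {x : A} {p} (zs : List A) → p List.∈ steps zs → p List.∈ steps (x ∷ zs)
∈-steps-∷ (z ∷ zs) = there

∈-steps-++⁺ʳ : ∀ {A : Set} {p} (xs : List A) {ys} → p List.∈ steps ys → p List.∈ steps (xs ++ ys)
∈-steps-++⁺ʳ []       p∈ = p∈
∈-steps-++⁺ʳ (x ∷ xs) p∈ = ∈-steps-∷ (xs ++ _) (∈-steps-++⁺ʳ xs p∈)

∈-steps-++⁺ˡ : ∀ {A : Set} {p} (xs : List A) {ys} → p List.∈ steps xs → p List.∈ steps (xs ++ ys)
∈-steps-++⁺ˡ (x ∷ y ∷ xs) (here refl) = here refl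
∈-steps-++⁺ˡ (x ∷ y ∷ xs) (there p∈)  = there (∈-steps-++⁺ˡ (y ∷ xs) p∈)

-- Entries consecutive in one path stay consecutive in the concatenation. For the paths of F this
-- gives a spanning sequence that traverses all edges of F.
Traverses-concat : ∀ {A : Set} {u v : A} (paths : List (List⁺ A)) →
                   Any (λ P → Traverses (toList P) u v) paths → Traverses (concat (map toList paths)) u v
Traverses-concat (P ∷ Ps) (here tr) = Sum.map (∈-steps-++⁺ˡ (toList P)) (∈-steps-++⁺ˡ (toList P)) tr
Traverses-concat (P ∷ Ps) (there a) =
  Sum.map (∈-steps-++⁺ʳ (toList P)) (∈-steps-++⁺ʳ (toList P)) (Traverses-concat Ps a)

Unique-resp-↭ : ∀ {A : Set} {xs ys : List A} → xs ↭ ys → Unique xs → Unique ys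
Unique-resp-↭ p = SetoidPerm.Unique-resp-↭ (setoid _) (↭⇒↭ₛ p)

-- How a tight step is read: if one of its two adjacencies fails, the other must hold and the step
-- is not an edge of F.
⟦⟧+⟦⟧≡1+⟦⟧ : {P Q R : Set} (P? : Dec P) (Q? : Dec Q) (R? : Dec R) →
             ⟦ P? ⟧ + ⟦ Q? ⟧ ≡ 1 + ⟦ R? ⟧ → ¬ Q → P × ¬ R
⟦⟧+⟦⟧≡1+⟦⟧ P?       (yes q) R?       eq ¬q = contradiction q ¬q
⟦⟧+⟦⟧≡1+⟦⟧ (yes p) (no _)  (no ¬r)  eq ¬q = p , ¬r

-- Adjacency and the graph with one more edge

adj-sym : (G : Graph n) {u v : Fin n} → Adj G u v → Adj G v u
adj-sym G = Graph.sym G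

¬adj-refl : (G : Graph n) {u : Fin n} → ¬ Adj G u u
¬adj-refl G = Graph.irrefl G refl

adj⇒≢ : (G : Graph n) {u v : Fin n} → Adj G u v → u ≢ v
adj⇒≢ G uv refl = ¬adj-refl G uv

same? : (a b u v : Fin n) → Dec (Same a b u v)
same? a b u v = ((a ≟ u) ×-dec (b ≟ v)) ⊎-dec ((a ≟ v) ×-dec (b ≟ u))

same-adj : (G : Graph n) {a b u v : Fin n} → Same a b u v → Adj G a b → Adj G u v
same-adj G (inj₁ (refl , refl)) = id
same-adj G (inj₂ (refl , refl)) = adj-sym G

same-¬adj : (G : Graph n) {a b u v : Fin n} → Same a b u v → Adj G u v → Adj G a b
same-¬adj G (inj₁ (refl , refl)) = id
same-¬adj G (inj₂ (refl , refl)) = adj-sym G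

addEdge : (G : Graph n) (u v : Fin n) → u ≢ v → Graph n
addEdge G u v u≢v = record
  { Adj    = λ x y → Adj G x y ⊎ Same u v x y
  ; sym    = Sum.map (adj-sym G) Same-sym
  ; irrefl = λ { refl (inj₁ xx) → ¬adj-refl G xx
               ; refl (inj₂ (inj₁ (refl , refl))) → u≢v refl
               ; refl (inj₂ (inj₂ (refl , refl))) → u≢v refl }
  ; adj?   = λ x y → adj? G x y ⊎-dec same? u v x y
  }

-- Hamiltonian paths and cycles through F

record HamPath (F G : Graph n) (u v : Fin n) : Set where
  constructor hamPath
  field
    seg      : Seg u v
    spanning : verts seg ↭ allFin n
    inG      : ∀ {x y} → Edge seg x y → Adj G x y
    covers   : ∀ {x y} → Adj F x y → Edge seg x y

-- A spanning path with a closing edge, which may itself belong to F. That the cycle has at least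
-- three vertices comes from n ≥ 3 in `toHamiltonianCycle`.
record HamCycle (F G : Graph n) : Set where
  constructor hamCycle
  field
    {first last} : Fin n
    seg      : Seg first last
    spanning : verts seg ↭ allFin n
    inG      : ∀ {x y} → Edge seg x y → Adj G x y
    closing  : Adj G last first
    covers   : ∀ {x y} → Adj F x y → Edge seg x y ⊎ Same last first x y

reversePath : {F G : Graph n} {u v : Fin n} → HamPath F G u v → HamPath F G v u
reversePath (hamPath s sp inG cov) =
  hamPath (rev s) (↭-trans (verts-rev s) sp) (inG ∘ Edge-rev⁻ s) (Edge-rev⁺ s ∘ cov)

module _ {s : List (Fin n)} (spanning : s ↭ allFin n) where

  spanning-unique : Unique s
  spanning-unique = Unique-resp-↭ (↭-sym spanning) (Unique.allFin⁺ n)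

  spanning-length : length s ≡ n
  spanning-length = trans (Perm.↭-length spanning) (length-tabulate id)

  spanning-∈ : ∀ v → v List.∈ s
  spanning-∈ v = Perm.∈-resp-↭ (↭-sym spanning) (∈-allFin v)

toHamiltonianCycle : {F G : Graph n} → 3 ≤ n → HamCycle F G → Σ[ Z ∈ HamiltonianCycle G ] Z ContainsEdgesOf F
toHamiltonianCycle {F = F} {G} 3≤n (hamCycle {a} {b} s sp inG ba cov) = record
  { vertices = verts s
  ; spanning = sp
  ; 3≤length = ≤-trans 3≤n (≤-reflexive (sym (spanning-length sp)))
  ; adjacent = subst (Linked (Adj G)) (sym (close-verts s)) (Edge⊆⇒Linked (s ⋈ [ a ]) closed)
  } , λ u v uv → subst (λ xs → Traverses xs u v) (sym (close-verts s))
        (Edge⇒Traverses (s ⋈ [ a ]) (Edge-⋈⁺ s [ a ] (Sum.map₂ inj₁ (cov uv))))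
  where
  closed : ∀ {u v} → Edge (s ⋈ [ a ]) u v → Adj G u v
  closed e with Edge-⋈⁻ s [ a ] e
  ... | inj₁ e′        = inG e′
  ... | inj₂ (inj₁ e′) = same-adj G e′ ba

module _ (F : Graph n) where

  -- `edgeCount` sees an edge only in the order of increasing index, so a step in F is charged to
  -- whichever of its two orders that is.
  stepSum-edges : {a b : Fin n} (s : Seg a b) → verts s ↭ allFin n →
                  stepSum (λ p q → ⟦ adj? F p q ⟧) s ≤ edgeCount F
  stepSum-edges s sp = begin
    stepSum (λ p q → ⟦ adj? F p q ⟧) s
      ≤⟨ stepSum-mono _ _ s (λ {p} {q} _ _ _ → ⟦⟧-cover (adj? F p q) (edge? p q) (edge? q p) (orient p q)) ⟩
    stepSum (λ p q → e p q + e q p) s      ≤⟨ stepSum-≤-∑-pairs e s ⟩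
    ∑-pairs (verts s) e                    ≡⟨ ∑-pairs-↭ e sp ⟩
    ∑-pairs (allFin n) e                   ≡⟨ ∑-cartesianProduct (allFin n) (allFin n) (λ (u , v) → e u v) ⟨
    ∑ (cartesianProduct (allFin n) (allFin n)) (λ (u , v) → e u v)
      ≡⟨ length-filter-∑ (λ (u , v) → edge? u v) (cartesianProduct (allFin n) (allFin n)) ⟨
    edgeCount F                            ∎
    where
    open ≤-Reasoning
    edge? : ∀ u v → Dec (u Fin.< v × Adj F u v)
    edge? u v = (u <? v) ×-dec adj? F u v
    e : Fin n → Fin n → ℕ
    e u v = ⟦ edge? u v ⟧
    orient : ∀ p q → Adj F p q → (p Fin.< q × Adj F p q) ⊎ (q Fin.< p × Adj F q p)
    orient p q pq with <-cmp p q
    ... | tri< p<q _ _ = inj₁ (p<q , pq)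
    ... | tri≈ _ refl _ = contradiction pq (¬adj-refl F)
    ... | tri> _ _ q<p = inj₂ (q<p , adj-sym F pq)

degree-on : (G : Graph n) {xs : List (Fin n)} → xs ↭ allFin n → ∀ u → ∑ xs (λ v → ⟦ adj? G u v ⟧) ≡ degree G u
degree-on {n} G sp u = trans (∑-↭ _ sp) (sym (length-filter-∑ (adj? G u) (allFin n)))

Crossing : (F G : Graph n) (u x p q : Fin n) → Set
Crossing F G u x p q = ⟦ adj? G u q ⟧ + ⟦ adj? G x p ⟧ ≡ 1 + ⟦ adj? F p q ⟧

-- If no edge pq of the path outside F has u ~ q and x ~ p, then each step of the path
-- contributes at most 1 + [pq ∈ F] to deg u + deg x.
crossing : {F G : Graph n} {u x : Fin n} (P : HamPath F G u x) →
           HamCycle F G ⊎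
           (suc (degree G u + degree G x) ≤ n + edgeCount F ×
            (n + edgeCount F ≤ suc (degree G u + degree G x) → AllSteps (HamPath.seg P) (Crossing F G u x)))
crossing {n} {F} {G} {u} {x} (hamPath s sp inG cov)
  with findStep (λ p q → adj? G u q ×-dec (adj? G x p ×-dec ¬? (adj? F p q))) s
-- The cycle is u ... p x ... q, closed by qu. Only the step pq is lost, and it is not in F.
... | inj₁ (split {p} {q} s₁ s₂ refl (uq , xp , ¬pq)) = inj₁
  (hamCycle (s₁ ⋈ rev s₂) (↭-trans (verts-⋈-cong {s = s₁} {t = rev s₂} ↭-refl (verts-rev s₂)) sp)
    inG′ (adj-sym G uq) cov′)
  where
  inG′ : ∀ {y z} → Edge (s₁ ⋈ rev s₂) y z → Adj G y z
  inG′ e with Edge-⋈⁻ s₁ (rev s₂) e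
  ... | inj₁ e′        = inG (Edge-⋈⁺ s₁ s₂ (inj₁ e′))
  ... | inj₂ (inj₁ e′) = same-adj G e′ (adj-sym G xp)
  ... | inj₂ (inj₂ e′) = inG (Edge-⋈⁺ s₁ s₂ (inj₂ (inj₂ (Edge-rev⁻ s₂ e′))))
  cov′ : ∀ {y z} → Adj F y z → Edge (s₁ ⋈ rev s₂) y z ⊎ Same q u y z
  cov′ yz with Edge-⋈⁻ s₁ s₂ (cov yz)
  ... | inj₁ e        = inj₁ (Edge-⋈⁺ s₁ (rev s₂) (inj₁ e))
  ... | inj₂ (inj₁ e) = contradiction (same-¬adj F e yz) ¬pq
  ... | inj₂ (inj₂ e) = inj₁ (Edge-⋈⁺ s₁ (rev s₂) (inj₂ (inj₂ (Edge-rev⁺ s₂ e))))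
... | inj₂ none = inj₂ (bound , tight)
  where
  open ≤-Reasoning
  f g : Fin n → Fin n → ℕ
  f p q = ⟦ adj? G u q ⟧ + ⟦ adj? G x p ⟧
  g p q = 1 + ⟦ adj? F p q ⟧
  f≤g : AllSteps s (λ p q → f p q ≤ g p q)
  f≤g {p} {q} s₁ s₂ eq with adj? G u q | adj? G x p | adj? F p q | none s₁ s₂ eq
  ... | yes uq | yes xp | yes pq | _  = ≤-refl
  ... | yes uq | yes xp | no ¬pq | ¬c = contradiction (uq , xp , ¬pq) ¬c
  ... | yes uq | no _   | _      | _  = s≤s z≤n
  ... | no _   | yes _  | _      | _  = s≤s z≤n
  ... | no _   | no _   | _      | _  = z≤n
  -- The sum over second entries omits u and the one over first entries omits x; these terms vanish
  -- since no vertex is adjacent to itself.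
  ∑f : stepSum f s ≡ degree G u + degree G x
  ∑f = trans (stepSum-+ _ _ s) (cong₂ _+_
    (trans (cong (_+ stepSum (λ _ q → ⟦ adj? G u q ⟧) s) (sym (⟦⟧-false (adj? G u u) (¬adj-refl G))))
           (trans (stepSum-second (λ q → ⟦ adj? G u q ⟧) s) (degree-on G sp u)))
    (trans (sym (+-identityʳ _)) (trans (cong (stepSum (λ p _ → ⟦ adj? G x p ⟧) s +_)
             (sym (⟦⟧-false (adj? G x x) (¬adj-refl G))))
           (trans (stepSum-first (λ p → ⟦ adj? G x p ⟧) s) (degree-on G sp x)))))
  -- A spanning path has n - 1 steps, whence the `suc`.
  ∑g : suc (stepSum g s) ≤ n + edgeCount F
  ∑g = begin
    suc (stepSum g s) ≡⟨ cong suc (stepSum-+ (λ _ _ → 1) (λ p q → ⟦ adj? F p q ⟧) s) ⟩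
    suc (stepSum (λ _ _ → 1) s) + stepSum (λ p q → ⟦ adj? F p q ⟧) s
      ≤⟨ +-mono-≤ (≤-reflexive (trans (stepSum-1 s) (spanning-length sp))) (stepSum-edges F s sp) ⟩
    n + edgeCount F ∎
  bound : suc (degree G u + degree G x) ≤ n + edgeCount F
  bound = ≤-trans (s≤s (≤-trans (≤-reflexive (sym ∑f)) (stepSum-mono f g s f≤g))) ∑g
  tight : n + edgeCount F ≤ suc (degree G u + degree G x) → AllSteps s (Crossing F G u x)
  tight le = stepSum-tight f g s f≤g (≤-trans (s≤s⁻¹ (≤-trans ∑g le)) (≤-reflexive (sym ∑f)))

module _ {F G : Graph n} (F⊆G : F ⊆ᴳ G) (3≤n : 3 ≤ n) where

  orientPath : {u v p q : Fin n} → Same u v p q → HamPath F G p q → HamPath F G u v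
  orientPath (inj₁ (refl , refl)) P = P
  orientPath (inj₂ (refl , refl)) P = reversePath P

  allAdj : {a b : Fin n} (s : Seg a b) → AllSteps s (λ p q → ¬ ¬ Adj G p q) → ∀ {y z} → Edge s y z → Adj G y z
  allAdj s all {y} {z} e = decidable-stable (adj? G y z)
    (AllSteps-Edge {Q = λ p q → ¬ ¬ Adj G p q} (λ ¬¬pq ¬qp → ¬¬pq (¬qp ∘ adj-sym G)) s all e)

  -- A step of the cycle outside G can only be uv, and cutting there leaves a path between u and v.
  -- No edge of F is lost, as F ⊆ G. If all steps are in G, the closing edge is examined in the same
  -- way.
  dropEdge : {u v : Fin n} (u≢v : u ≢ v) → HamCycle F (addEdge G u v u≢v) → HamCycle F G ⊎ HamPath F G u v
  dropEdge {u} {v} u≢v (hamCycle {a} {b} s sp inG+ ba cov) with findStep (λ p q → ¬? (adj? G p q)) s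
  ... | inj₁ (split {p} {q} s₁ s₂ refl ¬pq) =
    inj₂ (orientPath (Same-sym uv≡pq) (hamPath (s₂ ⋈ s₁) sp′ inG cov′))
    where
    uv≡pq : Same u v p q
    uv≡pq with inG+ (Edge-⋈⁺ s₁ s₂ (inj₂ (inj₁ (inj₁ (refl , refl)))))
    ... | inj₁ pq = contradiction pq ¬pq
    ... | inj₂ e  = e
    sp′ : verts (s₂ ⋈ s₁) ↭ allFin n
    sp′ = ↭-trans (verts-⋈-comm s₂ s₁) sp
    inG+′ : ∀ {y z} → Edge (s₂ ⋈ s₁) y z → Adj (addEdge G u v u≢v) y z
    inG+′ e with Edge-⋈⁻ s₂ s₁ e
    ... | inj₁ e′        = inG+ (Edge-⋈⁺ s₁ s₂ (inj₂ (inj₂ e′)))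
    ... | inj₂ (inj₁ e′) = same-adj (addEdge G u v u≢v) e′ ba
    ... | inj₂ (inj₂ e′) = inG+ (Edge-⋈⁺ s₁ s₂ (inj₁ e′))
    -- The path q ... b a ... p has the ends of uv as its own ends, so uv is not one of its edges.
    inG : ∀ {y z} → Edge (s₂ ⋈ s₁) y z → Adj G y z
    inG e with inG+′ e
    ... | inj₁ yz = yz
    ... | inj₂ e′ = contradiction (Same-comm (Same-trans uv≡pq e′))
      (¬Edge-ends (s₂ ⋈ s₁) (spanning-unique sp′) (≤-trans 3≤n (≤-reflexive (sym (spanning-length sp′)))) e)
    cov′ : ∀ {y z} → Adj F y z → Edge (s₂ ⋈ s₁) y z
    cov′ {y} {z} yz with cov yz
    ... | inj₂ e = Edge-⋈⁺ s₂ s₁ (inj₂ (inj₁ e))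
    ... | inj₁ e with Edge-⋈⁻ s₁ s₂ e
    ...   | inj₁ e′        = Edge-⋈⁺ s₂ s₁ (inj₂ (inj₂ e′))
    ...   | inj₂ (inj₁ e′) = contradiction (same-¬adj G e′ (F⊆G y z yz)) ¬pq
    ...   | inj₂ (inj₂ e′) = Edge-⋈⁺ s₂ s₁ (inj₁ e′)
  ... | inj₂ all with adj? G b a
  ...   | yes ba∈G = inj₁ (hamCycle s sp (allAdj s all) ba∈G cov)
  ...   | no ¬ba = inj₂ (orientPath (uv≡ab ba) (hamPath s sp (allAdj s all) cov′))
    where
    uv≡ab : Adj G b a ⊎ Same u v b a → Same u v a b
    uv≡ab (inj₁ ba) = contradiction ba ¬ba
    uv≡ab (inj₂ e)  = Same-sym e
    cov′ : ∀ {y z} → Adj F y z → Edge s y z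
    cov′ {y} {z} yz with cov yz
    ... | inj₁ e = e
    ... | inj₂ e = contradiction (same-¬adj G e (F⊆G y z yz)) ¬ba

module _ {F G : Graph n} {u x y t : Fin n} (u≢y : u ≢ y) (y≢x : y ≢ x) (t≢x : t ≢ x)
         (¬uy : ¬ Adj G u y) (¬xy : ¬ Adj G x y) (yt : Adj G y t) (¬xt : ¬ Adj G x t)
         (deg-ux : n + edgeCount F ≤ suc (degree G u + degree G x))
         (deg-yx : n + edgeCount F ≤ suc (degree G y + degree G x)) where

  private
    -- Let q follow t on Q′. As x ≁ t, tightness at the step tq gives y ~ q and tq ∉ F, so that y t
    -- ... p x ... q y is a cycle. It uses the edge xp and gives up only the step tq of Q′.
    insert : ∀ {p} (Q′ : Seg p x) (inG : ∀ {a b} → Edge Q′ a b → Adj G a b) →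
             (∀ {a b} → Adj F a b → Edge Q′ a b) →
             (y ∷ verts Q′) ↭ allFin n → Adj G x p →
             AllSteps (y ∷ Q′) (Crossing F G y x) → HamCycle F G
    insert Q′ inG cov sp xp tight with spanning-∈ sp t
    ... | here t≡y = contradiction (subst (Adj G y) t≡y yt) (¬adj-refl G)
    ... | there t∈ with q , s₃ , s₄ , refl ← splitAfter Q′ t∈ t≢x
                   with yq , ¬tq ← ⟦⟧+⟦⟧≡1+⟦⟧ (adj? G y q) (adj? G x t) (adj? F t q)
                                     (tight (y ∷ s₃) s₄ refl) ¬xt =
      hamCycle (y ∷ rev s₃ ⋈ rev s₄)
        (↭-trans (prep y (verts-⋈-cong {s = rev s₃} {t = rev s₄} (verts-rev s₃) (verts-rev s₄))) sp)
        inG′ (adj-sym G yq) cov′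
      where
      inG′ : ∀ {a b} → Edge (y ∷ rev s₃ ⋈ rev s₄) a b → Adj G a b
      inG′ (inj₁ e) = same-adj G e yt
      inG′ (inj₂ e) with Edge-⋈⁻ (rev s₃) (rev s₄) e
      ... | inj₁ e′        = inG (Edge-⋈⁺ s₃ s₄ (inj₁ (Edge-rev⁻ s₃ e′)))
      ... | inj₂ (inj₁ e′) = same-adj G e′ (adj-sym G xp)
      ... | inj₂ (inj₂ e′) = inG (Edge-⋈⁺ s₃ s₄ (inj₂ (inj₂ (Edge-rev⁻ s₄ e′))))
      cov′ : ∀ {a b} → Adj F a b → Edge (y ∷ rev s₃ ⋈ rev s₄) a b ⊎ Same q y a b
      cov′ ab with Edge-⋈⁻ s₃ s₄ (cov ab)
      ... | inj₁ e        = inj₁ (inj₂ (Edge-⋈⁺ (rev s₃) (rev s₄) (inj₁ (Edge-rev⁺ s₃ e))))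
      ... | inj₂ (inj₁ e) = contradiction (same-¬adj F e ab) ¬tq
      ... | inj₂ (inj₂ e) = inj₁ (inj₂ (Edge-⋈⁺ (rev s₃) (rev s₄) (inj₂ (inj₂ (Edge-rev⁺ s₄ e)))))

    -- With u … p y q … x on the given path, y can be moved to the front: y p … u q … x,
    -- and x ~ p makes the rest of this path a cycle through all vertices but y.
    reroute : ∀ {p q} (s₁ : Seg u p) (s₂ : Seg q x) → verts (s₁ ⋈ y ∷ s₂) ↭ allFin n →
              (∀ {a b} → Edge (s₁ ⋈ y ∷ s₂) a b → Adj G a b) →
              (∀ {a b} → Adj F a b → Edge (s₁ ⋈ y ∷ s₂) a b) →
              Adj G x p × ¬ Adj F p y → Adj G u q × ¬ Adj F y q → HamCycle F G
    reroute {p} {q} s₁ s₂ sp inG cov (xp , ¬py) (uq , ¬yq) =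
      -- The new path from y to x either closes at once or is tight too, by the degree sum of y and
      -- x.
      Sum.[ id , (λ (_ , tight) → insert Q′ (inG′ ∘ inj₂) cov′ sp′ xp (tight deg-yx)) ]′
        (crossing (hamPath (y ∷ Q′) sp′ inG′ (inj₂ ∘ cov′)))
      where
      Q′ = rev s₁ ⋈ s₂
      sp′ : y ∷ verts Q′ ↭ allFin n
      sp′ = ↭-trans (prep y (↭-trans (verts-⋈-cong {s = rev s₁} {t = s₂} (verts-rev s₁) ↭-refl)
                                     (↭-reflexive (verts-⋈ s₁ s₂))))
        (↭-trans (↭-sym (Perm.shift y (verts s₁) (verts s₂)))
          (↭-trans (↭-reflexive (sym (verts-⋈ s₁ (y ∷ s₂)))) sp))
      inG′ : ∀ {a b} → Edge (y ∷ Q′) a b → Adj G a b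
      inG′ (inj₁ e) = same-adj G (Same-comm e) (inG (Edge-⋈⁺ s₁ (y ∷ s₂) (inj₂ (inj₁ (inj₁ (refl , refl))))))
      inG′ (inj₂ e) with Edge-⋈⁻ (rev s₁) s₂ e
      ... | inj₁ e′        = inG (Edge-⋈⁺ s₁ (y ∷ s₂) (inj₁ (Edge-rev⁻ s₁ e′)))
      ... | inj₂ (inj₁ e′) = same-adj G e′ uq
      ... | inj₂ (inj₂ e′) = inG (Edge-⋈⁺ s₁ (y ∷ s₂) (inj₂ (inj₂ (inj₂ e′))))
      cov′ : ∀ {a b} → Adj F a b → Edge Q′ a b
      cov′ ab with Edge-⋈⁻ s₁ (y ∷ s₂) (cov ab)
      ... | inj₁ e               = Edge-⋈⁺ (rev s₁) s₂ (inj₁ (Edge-rev⁺ s₁ e))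
      ... | inj₂ (inj₁ e)        = contradiction (same-¬adj F e ab) ¬py
      ... | inj₂ (inj₂ (inj₁ e)) = contradiction (same-¬adj F e ab) ¬yq
      ... | inj₂ (inj₂ (inj₂ e)) = Edge-⋈⁺ (rev s₁) s₂ (inj₂ (inj₂ e))

  -- The vertex y lies inside the path, say between p and q. Tightness of py with u ≁ y gives x ~ p,
  -- tightness of yq with x ≁ y gives u ~ q, and neither step is in F.
  tightPath⇒HamCycle : HamPath F G u x → HamCycle F G
  tightPath⇒HamCycle P@(hamPath s sp inG cov) with crossing P
  ... | inj₁ Z = Z
  ... | inj₂ (_ , tight) with splitBefore s (spanning-∈ sp y)
  ...   | inj₁ y≡u = contradiction (sym y≡u) u≢y
  ...   | inj₂ (p , s₁ , [ _ ] , refl) = contradiction refl y≢x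
  ...   | inj₂ (p , s₁ , (_∷_ _ {q} s₂) , refl) = reroute s₁ s₂ sp inG cov
    (⟦⟧+⟦⟧≡1+⟦⟧ (adj? G x p) (adj? G u y) (adj? F p y)
      (trans (+-comm ⟦ adj? G x p ⟧ _) (tight deg-ux s₁ (y ∷ s₂) refl)) ¬uy)
    (⟦⟧+⟦⟧≡1+⟦⟧ (adj? G u q) (adj? G x y) (adj? F y q)
      (tight deg-ux (s₁ ⋈ [ y ]) s₂ (sym (⋈-assoc s₁ [ y ] s₂))) ¬xy)

-- The paths of F, put one after another, form a spanning path, which a complete graph lets one join
-- up and close.
complete⇒HamCycle : {F G : Graph n} → 2 ≤ n → IsLinearForest F → (∀ u v → u ≢ v → Adj G u v) → HamCycle F G
complete⇒HamCycle {n} {F} {G} 2≤n (paths , sp , edges) complete with concat (map toList paths) in eq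
... | [] = contradiction (subst (2 ≤_) (sym (spanning-length sp)) 2≤n) λ ()
... | x ∷ xs with b , s , eq′ ← fromList x xs =
  hamCycle s sp′ (λ e → complete _ _ (Edge-irrefl s (spanning-unique sp′) e))
    (complete b x (first≢last s (spanning-unique sp′)
      (≤-trans 2≤n (≤-reflexive (sym (spanning-length sp′)))) ∘ sym))
    (λ uv → inj₁ (Traverses⇒Edge s (subst (λ zs → Traverses zs _ _) (trans eq (sym eq′))
      (Traverses-concat paths (Equivalence.to (edges _ _) uv)))))
  where
  sp′ : verts s ↭ allFin n
  sp′ = ↭-trans (↭-reflexive eq′) sp

-- Adding edges

-- The induction measure. Ordered pairs and the diagonal are included, which is harmless because
-- only its decrease matters.
missing : Graph n → ℕ
missing {n} G = ∑-pairs (allFin n) (λ u v → ⟦ ¬? (adj? G u v) ⟧)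

missing-addEdge : (G : Graph n) {u v : Fin n} (u≢v : u ≢ v) → ¬ Adj G u v →
                  missing (addEdge G u v u≢v) < missing G
missing-addEdge {n} G {u} {v} u≢v ¬uv = ∑-mono-< (λ x → ∑-mono (allFin n) (le x)) (∈-allFin u)
  (∑-mono-< (le u) (∈-allFin v) (subst₂ _<_
    (sym (⟦⟧-false (¬? (adj? G+ u v)) (λ ¬uv+ → ¬uv+ (inj₂ (inj₁ (refl , refl))))))
    (sym (⟦⟧-true (¬? (adj? G u v)) ¬uv)) (s≤s z≤n)))
  where
  G+ = addEdge G u v u≢v
  le : ∀ x y → ⟦ ¬? (adj? G+ x y) ⟧ ≤ ⟦ ¬? (adj? G x y) ⟧
  le x y = ⟦⟧-mono (¬? (adj? G+ x y)) (¬? (adj? G x y)) (_∘ inj₁)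

-- Being a subgraph of H or H′ up to isomorphism, as a condition that is plainly decidable.
ShapeH : (d ℓ : ℕ) → Graph n → Set
ShapeH {n} d ℓ G = ∃[ A ] ∃[ B ] B ⊆ A × ∣ A ∣ ≡ n ∸ d + ℓ × ∣ B ∣ ≡ d ×
  (∀ u v → Adj G u v → (u ∈ A × v ∈ A) ⊎ (u ∈ B × v ∉ A) ⊎ (v ∈ B × u ∉ A))

ShapeH′ : (d ℓ : ℕ) → Graph n → Set
ShapeH′ {n} d ℓ G = ∃[ P ] ∃[ Q ] ∣ P ∣ ≡ n ∸ d + ℓ × ∣ Q ∣ ≡ suc d ×
  (∀ v → v ∈ P ⊎ v ∈ Q) × (∀ u v → Adj G u v → (u ∈ P × v ∈ P) ⊎ (u ∈ Q × v ∈ Q))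

Shape : (d ℓ : ℕ) → Graph n → Set
Shape d ℓ G = ShapeH d ℓ G ⊎ ShapeH′ d ℓ G

shape-⊆ : ∀ {d ℓ} {G G′ : Graph n} → G ⊆ᴳ G′ → Shape d ℓ G′ → Shape d ℓ G
shape-⊆ G⊆G′ (inj₁ (A , B , B⊆A , a , b , edges)) =
  inj₁ (A , B , B⊆A , a , b , λ u v uv → edges u v (G⊆G′ u v uv))
shape-⊆ G⊆G′ (inj₂ (P , Q , p , q , all , edges)) =
  inj₂ (P , Q , p , q , all , λ u v uv → edges u v (G⊆G′ u v uv))

module _ {G G′ : Graph n} (G⊆G′ : G ⊆ᴳ G′) where

  degree-⊆ : ∀ v → degree G v ≤ degree G′ v
  degree-⊆ v = subst₂ _≤_ (sym (degree≡# G v)) (sym (degree≡# G′ v)) (#-mono (adj? G v) (adj? G′ v) (G⊆G′ v))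

  fewLow-⊆ : ∀ {d ℓ m} → FewLow d ℓ m G → FewLow d ℓ m G′
  fewLow-⊆ {ℓ = ℓ} few j j≤m j∈ = ≤-<-trans
    (+-monoˡ-≤ ℓ (#-mono (low? G′ j) (low? G j) (λ v → ≤-trans (degree-⊆ v)))) (few j j≤m j∈)

-- Graphs closed under the degree-sum rule of Bondy and Chvátal

Closed : ℕ → Graph n → Set
Closed k G = ∀ u v → u ≢ v → ¬ Adj G u v → degree G u + degree G v < k

module _ {n} {ℓ m : ℕ} (G : Graph n) (closed : Closed (n + ℓ) G)
         (m-max : ∀ j → j + j < n + ℓ → j ≤ m) where

  -- Take a non-adjacent pair u, v with deg u ≤ deg v and maximal degree sum: every
  -- non-neighbour of v then has degree at most j = deg u.
  nonadjacent⇒manyLow : ∀ t u v → u ≢ v → ¬ Adj G u v → t ≤ degree G u → t ≤ degree G v →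
                        ∃[ j ] t ≤ j × j ≤ m × j ≤ # (low? G j) + ℓ
  nonadjacent⇒manyLow t u v u≢v ¬uv t≤u t≤v = go (n + ℓ) u v u≢v ¬uv t≤u t≤v (m≤m+n _ _)
    where
    -- k bounds the amount by which deg u + deg v falls short of n + ℓ. Replacing u by a
    -- non-neighbour of v of larger degree decreases it, and at 0 the pair would contradict
    -- closedness.
    go : ∀ k u v → u ≢ v → ¬ Adj G u v → t ≤ degree G u → t ≤ degree G v →
         n + ℓ ≤ k + (degree G u + degree G v) → ∃[ j ] t ≤ j × j ≤ m × j ≤ # (low? G j) + ℓ
    ordered : ∀ k u v → u ≢ v → ¬ Adj G u v → t ≤ degree G u → t ≤ degree G v → degree G u ≤ degree G v →
              n + ℓ ≤ suc k + (degree G u + degree G v) → ∃[ j ] t ≤ j × j ≤ m × j ≤ # (low? G j) + ℓ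
    go zero u v u≢v ¬uv _ _ le = contradiction le (<⇒≱ (closed u v u≢v ¬uv))
    go (suc k) u v u≢v ¬uv t≤u t≤v le with ≤-total (degree G u) (degree G v)
    ... | inj₁ u≤v = ordered k u v u≢v ¬uv t≤u t≤v u≤v le
    ... | inj₂ v≤u = ordered k v u (u≢v ∘ sym) (¬uv ∘ adj-sym G) t≤v t≤u v≤u
      (≤-trans le (≤-reflexive (cong (suc k +_) (+-comm (degree G u) _))))
    ordered k u v u≢v ¬uv t≤u t≤v u≤v le
      with any? (λ w → ¬? (w ≟ v) ×-dec (¬? (adj? G w v) ×-dec (degree G u ℕ.<? degree G w)))
    ... | yes (w , w≢v , ¬wv , u<w) = go k w v w≢v ¬wv (≤-trans t≤u (<⇒≤ u<w)) t≤v
      (≤-trans le (≤-trans (≤-reflexive (sym (+-suc k _))) (+-monoʳ-≤ k (+-monoˡ-≤ _ u<w))))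
    ... | no none = degree G u , t≤u ,
      -- As u has the smaller degree, 2j ≤ deg u + deg v < n + ℓ.
      m-max (degree G u) (≤-<-trans (+-monoʳ-≤ _ u≤v) (closed u v u≢v ¬uv)) ,
      +-cancelˡ-≤ (suc (degree G v)) _ _ (begin
        suc (degree G v + degree G u)        ≡⟨ cong suc (+-comm (degree G v) _) ⟩
        suc (degree G u + degree G v)        ≤⟨ closed u v u≢v ¬uv ⟩
        n + ℓ                                ≤⟨ +-monoˡ-≤ ℓ count ⟩
        suc (degree G v) + # (low? G j) + ℓ  ≡⟨ +-assoc (suc (degree G v)) _ ℓ ⟩
        suc (degree G v) + (# (low? G j) + ℓ) ∎)
      where
      open ≤-Reasoning
      j = degree G u
      cases : ∀ w → (w ≡ v ⊎ Adj G v w) ⊎ degree G w ≤ j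
      cases w with w ≟ v | adj? G v w
      ... | yes w≡v | _      = inj₁ (inj₁ w≡v)
      ... | no _    | yes vw = inj₁ (inj₂ vw)
      ... | no w≢v  | no ¬vw = inj₂ (≮⇒≥ λ lt → none (w , w≢v , ¬vw ∘ adj-sym G , lt))
      near? : ∀ w → Dec (w ≡ v ⊎ Adj G v w)
      near? w = (w ≟ v) ⊎-dec adj? G v w
      any-vertex? : ∀ w → Dec ((w ≡ v ⊎ Adj G v w) ⊎ degree G w ≤ j)
      any-vertex? w = near? w ⊎-dec low? G j w
      count : n ≤ suc (degree G v) + # (low? G j)
      count = begin
        n                                  ≡⟨ #-all any-vertex? cases ⟨
        # any-vertex?                      ≤⟨ #-cover any-vertex? near? (low? G j) (λ _ → id) ⟩
        # near? + # (low? G j)             ≤⟨ +-monoˡ-≤ _ (#-cover near? (_≟ v) (adj? G v) (λ _ → id)) ⟩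
        # (_≟ v) + # (adj? G v) + # (low? G j)
          ≡⟨ cong₂ (λ a b → a + b + # (low? G j)) (#-singleton v) (sym (degree≡# G v)) ⟩
        suc (degree G v) + # (low? G j)    ∎

-- In the application w, y, t have degree d and x is a vertex of larger degree without
-- neighbours of degree d.
record Obstacle (ℓ : ℕ) (G : Graph n) : Set where
  field
    {w x y t} : Fin n
    w≢x : w ≢ x
    w≢y : w ≢ y
    y≢x : y ≢ x
    t≢x : t ≢ x
    ¬wx : ¬ Adj G w x
    ¬wy : ¬ Adj G w y
    ¬xy : ¬ Adj G x y
    yt  : Adj G y t
    ¬xt : ¬ Adj G x t
    deg-wx : n + ℓ ≤ suc (degree G w + degree G x)
    deg-yx : n + ℓ ≤ suc (degree G y + degree G x)

-- The vertices of degree d in a closed graph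

module _ {n ℓ d m : ℕ} (G : Graph n) (ℓ<d : ℓ < d) (d≤m : d ≤ m) (2m<n+ℓ : m + m < n + ℓ)
         (closed : Closed (n + ℓ) G) (d≤degree : ∀ v → d ≤ degree G v) (few : FewLow d ℓ m G)
         (clique : ∀ u v → d < degree G u → d < degree G v → u ≢ v → Adj G u v)
         (#low≡ : # (low? G d) + ℓ ≡ d) where

  private
    D : Fin n → Set
    D v = degree G v ≤ d
    D? : ∀ v → Dec (D v)
    D? = low? G d

    high : Subset n
    high = subset (¬? ∘ D?)

    deg≡d : ∀ {v} → D v → # (adj? G v) ≡ d
    deg≡d {v} Dv = trans (sym (degree≡# G v)) (≤-antisym Dv (d≤degree v))

    #high+d : # (¬? ∘ D?) + d ≡ n + ℓ
    #high+d = begin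
      # (¬? ∘ D?) + d               ≡⟨ cong (# (¬? ∘ D?) +_) #low≡ ⟨
      # (¬? ∘ D?) + (# D? + ℓ)      ≡⟨ +-assoc (# (¬? ∘ D?)) _ ℓ ⟨
      # (¬? ∘ D?) + # D? + ℓ        ≡⟨ cong (_+ ℓ) (#-complement D?) ⟩
      n + ℓ                         ∎
      where open ≡-Reasoning

    high-adj : ∀ {u v} → ¬ D u → ¬ D v → u ≢ v → Adj G u v
    high-adj ¬Du ¬Dv = clique _ _ (≰⇒> ¬Du) (≰⇒> ¬Dv)

    near? : ∀ w v → Dec (v ≡ w ⊎ Adj G w v)
    near? w v = (v ≟ w) ⊎-dec adj? G w v

    #near : ∀ w → # (near? w) ≡ suc (degree G w)
    #near w = trans (≤-antisym (#-cover (near? w) (_≟ w) (adj? G w) (λ _ → id))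
        (#-disjoint (_≟ w) (adj? G w) (near? w) (λ _ → inj₁) (λ _ → inj₂) λ { _ refl ww → ¬adj-refl G ww }))
      (cong₂ _+_ (#-singleton w) (sym (degree≡# G w)))

    high-near : ∀ {w} → ¬ D w → ∀ v → ¬ D v → v ≡ w ⊎ Adj G w v
    high-near {w} ¬Dw v ¬Dv with v ≟ w
    ... | yes v≡w = inj₁ v≡w
    ... | no  v≢w = inj₂ (high-adj ¬Dw ¬Dv (v≢w ∘ sym))

    -- A vertex w outside D is adjacent to all other such vertices, so its degree is at least n + ℓ
    -- - d - 1, while u has degree at least d.
    deg-low+high : ∀ {u w} → ¬ D w → n + ℓ ≤ suc (degree G u + degree G w)
    deg-low+high {u} {w} ¬Dw = begin
      n + ℓ                         ≡⟨ #high+d ⟨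
      # (¬? ∘ D?) + d               ≤⟨ +-mono-≤ (≤-trans (#-mono (¬? ∘ D?) (near? w) (high-near ¬Dw))
                                                         (≤-reflexive (#near w))) (d≤degree u) ⟩
      suc (degree G w + degree G u) ≡⟨ cong suc (+-comm (degree G w) _) ⟩
      suc (degree G u + degree G w) ∎
      where open ≤-Reasoning

    -- One neighbour in D raises the degree of w to at least n + ℓ - d. Its degree sum with any v in
    -- D then reaches n + ℓ, and closedness forces the edge.
    dominates : ∀ {w u v} → ¬ D w → D u → D v → Adj G w u → Adj G w v
    dominates {w} {u} {v} ¬Dw Du Dv wu with adj? G w v
    ... | yes wv = wv
    ... | no ¬wv = contradiction (closed w v (λ { refl → ¬Dw Dv }) ¬wv) (≤⇒≯ (begin
      n + ℓ                         ≡⟨ #high+d ⟨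
      # (¬? ∘ D?) + d               ≤⟨ +-mono-≤ (s≤s⁻¹ (begin
          suc (# (¬? ∘ D?))           ≡⟨ cong (_+ # (¬? ∘ D?)) (#-singleton u) ⟨
          # (_≟ u) + # (¬? ∘ D?)      ≤⟨ #-disjoint (_≟ u) (¬? ∘ D?) (near? w) (λ { _ refl → inj₂ wu })
                                           (high-near ¬Dw) (λ { _ refl ¬Du → ¬Du Du }) ⟩
          # (near? w)                 ≡⟨ #near w ⟩
          suc (degree G w)            ∎)) (d≤degree v) ⟩
      degree G w + degree G v       ∎))
      where open ≤-Reasoning

    module _ (u₀ : Fin n) (Du₀ : D u₀) where

      W? : ∀ v → Dec (¬ D v × Adj G u₀ v)
      W? v = ¬? (D? v) ×-dec adj? G u₀ v

      W : Subset n
      W = subset W?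

      -- With its converse `W⁻`, this shows that W does not depend on the choice of u₀ in D.
      W⁺ : ∀ {u w} → D u → ¬ D w → Adj G u w → Adj G u₀ w
      W⁺ Du ¬Dw uw = adj-sym G (dominates ¬Dw Du Du₀ (adj-sym G uw))

      W⁻ : ∀ {u w} → D u → ¬ D w → Adj G u₀ w → Adj G u w
      W⁻ Du ¬Dw u₀w = adj-sym G (dominates ¬Dw Du₀ Du (adj-sym G u₀w))

      ∣high∣ : ∣ high ∣ ≡ n ∸ d + ℓ
      ∣high∣ = begin
        ∣ high ∣              ≡⟨ ∣subset∣ (¬? ∘ D?) ⟩
        # (¬? ∘ D?)           ≡⟨ m+n∸n≡m _ d ⟨
        # (¬? ∘ D?) + d ∸ d   ≡⟨ cong (_∸ d) #high+d ⟩
        n + ℓ ∸ d             ≡⟨ +-∸-comm ℓ d≤n ⟩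
        n ∸ d + ℓ             ∎
        where
        open ≡-Reasoning
        d≤n : d ≤ n
        d≤n = s≤s⁻¹ (≤-trans (s≤s (d≤degree u₀)) (≤-trans (≤-reflexive (sym (#near u₀)))
          (≤-trans (m≤n+m _ (# (¬? ∘ near? u₀)))
            (≤-trans (≤-reflexive (#-complement (near? u₀))) (n≤1+n n)))))

      -- A consists of the vertices outside D, and B is W, which contains all d neighbours of u₀.
      independent⇒ShapeH : (∀ u v → D u → D v → ¬ Adj G u v) → ShapeH d ℓ G
      independent⇒ShapeH indep = high , W ,
        ∈-subset⁺ (¬? ∘ D?) ∘ proj₁ ∘ ∈-subset⁻ W? , ∣high∣ ,
        trans (∣subset∣ W?) (trans
          (#-cong W? (adj? G u₀) (λ _ → proj₂) (λ v u₀v → (λ Dv → indep u₀ v Du₀ Dv u₀v) , u₀v)) (deg≡d Du₀)) ,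
        edges
        where
        edges : ∀ u v → Adj G u v → (u ∈ high × v ∈ high) ⊎ (u ∈ W × v ∉ high) ⊎ (v ∈ W × u ∉ high)
        edges u v uv with D? u | D? v
        ... | yes Du | yes Dv = contradiction uv (indep u v Du Dv)
        ... | yes Du | no ¬Dv = inj₂ (inj₂ (∈-subset⁺ W? (¬Dv , W⁺ Du ¬Dv uv) ,
          λ u∈high → ∈-subset⁻ (¬? ∘ D?) u∈high Du))
        ... | no ¬Du | yes Dv = inj₂ (inj₁ (∈-subset⁺ W? (¬Du , W⁺ Dv ¬Du (adj-sym G uv)) ,
          λ v∈high → ∈-subset⁻ (¬? ∘ D?) v∈high Dv))
        ... | no ¬Du | no ¬Dv = inj₁ (∈-subset⁺ (¬? ∘ D?) ¬Du , ∈-subset⁺ (¬? ∘ D?) ¬Dv)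

      -- P consists of the vertices outside D, and Q is the closed neighbourhood of u₀, that is D ∪
      -- W.
      clique⇒ShapeH′ : (∀ u v → D u → D v → u ≢ v → Adj G u v) → ShapeH′ d ℓ G
      clique⇒ShapeH′ low-adj = high , N[u₀] , ∣high∣ ,
        trans (∣subset∣ (near? u₀)) (trans (#near u₀) (cong suc (trans (degree≡# G u₀) (deg≡d Du₀)))) ,
        cases , edges
        where
        N[u₀] = subset (near? u₀)
        low-N : ∀ {v} → D v → v ∈ N[u₀]
        low-N {v} Dv with v ≟ u₀
        ... | yes v≡u₀ = ∈-subset⁺ (near? u₀) (inj₁ v≡u₀)
        ... | no  v≢u₀ = ∈-subset⁺ (near? u₀) (inj₂ (low-adj u₀ v Du₀ Dv (v≢u₀ ∘ sym)))
        nbr-N : ∀ {u v} → D u → Adj G u v → v ∈ N[u₀]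
        nbr-N {u} {v} Du uv with D? v
        ... | yes Dv = low-N Dv
        ... | no ¬Dv = ∈-subset⁺ (near? u₀) (inj₂ (W⁺ Du ¬Dv uv))
        cases : ∀ v → v ∈ high ⊎ v ∈ N[u₀]
        cases v with D? v
        ... | yes Dv = inj₂ (low-N Dv)
        ... | no ¬Dv = inj₁ (∈-subset⁺ (¬? ∘ D?) ¬Dv)
        edges : ∀ u v → Adj G u v → (u ∈ high × v ∈ high) ⊎ (u ∈ N[u₀] × v ∈ N[u₀])
        edges u v uv with D? u | D? v
        ... | no ¬Du | no ¬Dv = inj₁ (∈-subset⁺ (¬? ∘ D?) ¬Du , ∈-subset⁺ (¬? ∘ D?) ¬Dv)
        ... | yes Du | _      = inj₂ (low-N Du , nbr-N Du uv)
        ... | no ¬Du | yes Dv = inj₂ (nbr-N Dv (adj-sym G uv) , low-N Dv)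

      -- The d neighbours of a include all of W and also b, which lies in D.
      #W<d : ∀ {a b} → D a → D b → Adj G a b → # W? < d
      #W<d {a} {b} Da Db ab = begin
        suc (# W?)       ≡⟨ cong (_+ # W?) (#-singleton b) ⟨
        # (_≟ b) + # W?  ≤⟨ #-disjoint (_≟ b) W? (adj? G a) (λ { _ refl → ab })
                              (λ v (¬Dv , u₀v) → W⁻ Da ¬Dv u₀v) (λ { _ refl (¬Db , _) → ¬Db Db }) ⟩
        # (adj? G a)     ≡⟨ deg≡d Da ⟩
        d                ∎
        where open ≤-Reasoning

      obstacle : ∀ {a b u y} → D a → D b → Adj G a b → D u → D y → u ≢ y → ¬ Adj G u y → Obstacle ℓ G
      obstacle {a} {b} {u} {y} Da Db ab Du Dy w≢y ¬wy
        -- W is too small to contain all d neighbours of y; a neighbour t outside W must lie in D.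
        with t , yt , ¬Wt ← #-< W? (adj? G y) (<-≤-trans (#W<d Da Db ab) (≤-reflexive (sym (deg≡d Dy))))
        with any? (λ x → ¬? (D? x) ×-dec ¬? (adj? G u₀ x))
      ... | yes (x , ¬Dx , ¬u₀x) = record
        { w≢x = λ { refl → ¬Dx Du } ; w≢y = w≢y ; y≢x = λ { refl → ¬Dx Dy } ; t≢x = λ { refl → ¬Dx Dt }
        ; ¬wx = ¬u₀x ∘ W⁺ Du ¬Dx ; ¬wy = ¬wy ; ¬xy = ¬u₀x ∘ W⁺ Dy ¬Dx ∘ adj-sym G ; yt = yt
        ; ¬xt = ¬u₀x ∘ W⁺ Dt ¬Dx ∘ adj-sym G
        ; deg-wx = deg-low+high ¬Dx ; deg-yx = deg-low+high ¬Dx }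
        where
        Dt : D t
        Dt = decidable-stable (D? t) (λ ¬Dt → ¬Wt (¬Dt , W⁺ Dy ¬Dt yt))
      -- If u₀ were adjacent to every vertex outside D, there would be at most d of these, and n + ℓ
      -- ≤ 2d ≤ 2m.
      ... | no none = contradiction 2m<n+ℓ (≤⇒≯ (begin
        n + ℓ                 ≡⟨ #high+d ⟨
        # (¬? ∘ D?) + d       ≤⟨ +-monoˡ-≤ d (≤-trans (#-mono (¬? ∘ D?) (adj? G u₀)
                                   (λ v ¬Dv → decidable-stable (adj? G u₀ v) (λ ¬u₀v → none (v , ¬Dv , ¬u₀v))))
                                   (≤-reflexive (deg≡d Du₀))) ⟩
        d + d                 ≤⟨ +-mono-≤ d≤m d≤m ⟩
        m + m                 ∎))
        where open ≤-Reasoning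

  lowClique⇒Shape⊎Obstacle : Shape d ℓ G ⊎ Obstacle ℓ G
  lowClique⇒Shape⊎Obstacle
    with u₀ , Du₀ ← #-pos D? (n≢0⇒n>0 λ eq → <⇒≢ ℓ<d (trans (cong (_+ ℓ) (sym eq)) #low≡))
    with any? (λ a → any? (λ b → D? a ×-dec (D? b ×-dec adj? G a b)))
       | any? (λ u → any? (λ y → D? u ×-dec (D? y ×-dec (¬? (u ≟ y) ×-dec ¬? (adj? G u y)))))
  ... | no none | _ = inj₁ (inj₁ (independent⇒ShapeH u₀ Du₀ (λ u v Du Dv uv → none (u , v , Du , Dv , uv))))
  ... | yes _ | no none = inj₁ (inj₂ (clique⇒ShapeH′ u₀ Du₀ (λ u v Du Dv u≢v →
    decidable-stable (adj? G u v) (λ ¬uv → none (u , v , Du , Dv , u≢v , ¬uv)))))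
  ... | yes (a , b , Da , Db , ab) | yes (u , y , Du , Dy , w≢y , ¬wy) =
    inj₂ (obstacle u₀ Du₀ Da Db ab Du Dy w≢y ¬wy)

-- The induction on missing edges

module _ {n d m : ℕ} {F : Graph n} (forest : IsLinearForest F) (3≤n : 3 ≤ n)
         (ℓ<d : edgeCount F < d) (d≤m : d ≤ m) (2m<n+ℓ : m + m < n + edgeCount F)
         (m-max : ∀ j → j + j < n + edgeCount F → j ≤ m) where

  private
    ℓ = edgeCount F

  closed-cases : (G : Graph n) → Closed (n + ℓ) G → (∀ v → d ≤ degree G v) → FewLow d ℓ m G →
                 HamCycle F G ⊎ Shape d ℓ G ⊎ Obstacle ℓ G
  closed-cases G closed d≤degree few with any? (λ u → any? (λ v → ¬? (u ≟ v) ×-dec ¬? (adj? G u v)))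
  ... | no none = inj₁ (complete⇒HamCycle (≤-trans (n≤1+n 2) 3≤n) forest
    (λ u v u≢v → decidable-stable (adj? G u v) (λ ¬uv → none (u , v , u≢v , ¬uv))))
  ... | yes (u , v , u≢v , ¬uv) = inj₂
    (lowClique⇒Shape⊎Obstacle {m = m} G ℓ<d d≤m 2m<n+ℓ closed d≤degree few clique #low≡)
    where
    -- A non-adjacent pair of degrees above d would yield some j with d < j ≤ m that violates `few`.
    clique : ∀ u v → d < degree G u → d < degree G v → u ≢ v → Adj G u v
    clique u v d<u d<v u≢v = decidable-stable (adj? G u v) λ ¬uv →
      let j , d<j , j≤m , j≤low = nonadjacent⇒manyLow {ℓ = ℓ} G closed m-max (suc d) u v u≢v ¬uv d<u d<v
      in <⇒≱ (few j j≤m (inj₁ d<j)) j≤low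
    -- The pair u, v yields j ≥ d with many low vertices. `few` excludes j > d and j = m, so j = d <
    -- m; the reverse inequality is `few` at d + 1.
    #low≡ : # (low? G d) + ℓ ≡ d
    #low≡ with j , d≤j , j≤m , j≤low ←
            nonadjacent⇒manyLow {ℓ = ℓ} G closed m-max d u v u≢v ¬uv (d≤degree u) (d≤degree v)
          with m≤n⇒m<n∨m≡n d≤j | m≤n⇒m<n∨m≡n d≤m
    ... | inj₁ d<j  | _         = contradiction j≤low (<⇒≱ (few j j≤m (inj₁ d<j)))
    ... | inj₂ refl | inj₂ d≡m  = contradiction j≤low (<⇒≱ (few d d≤m (inj₂ d≡m)))
    ... | inj₂ refl | inj₁ d<m  = ≤-antisym (s≤s⁻¹ (≤-<-trans
      (+-monoˡ-≤ ℓ (#-mono (low? G d) (low? G (suc d)) (λ _ → m≤n⇒m≤1+n)))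
      (few (suc d) d<m (inj₁ ≤-refl)))) j≤low

  HamCycle⊎Shape : (G : Graph n) → F ⊆ᴳ G → (∀ v → d ≤ degree G v) → FewLow d ℓ m G →
                   HamCycle F G ⊎ Shape d ℓ G
  HamCycle⊎Shape G = go (suc (missing G)) G ≤-refl
    where
    go : ∀ k (G : Graph n) → missing G < k → F ⊆ᴳ G → (∀ v → d ≤ degree G v) → FewLow d ℓ m G →
         HamCycle F G ⊎ Shape d ℓ G
    -- A shape of G + uv is inherited by G; a cycle of G + uv leaves a cycle of G or a path from u
    -- to v, which `finish` turns into a cycle.
    viaEdge : ∀ k (G : Graph n) → missing G ≤ k → F ⊆ᴳ G → (∀ v → d ≤ degree G v) → FewLow d ℓ m G →
              ∀ {u v} → u ≢ v → ¬ Adj G u v → (HamPath F G u v → HamCycle F G) → HamCycle F G ⊎ Shape d ℓ G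
    go (suc k) G missing<k F⊆G d≤degree few
      with any? (λ u → any? (λ v → ¬? (u ≟ v) ×-dec (¬? (adj? G u v) ×-dec
             (n + ℓ ≤? degree G u + degree G v))))
    ... | yes (u , v , u≢v , ¬uv , le) = viaEdge k G (s≤s⁻¹ missing<k) F⊆G d≤degree few u≢v ¬uv
      λ P → Sum.[ id , (λ (bound , _) → contradiction le (<⇒≱ bound)) ]′ (crossing P)
    ... | no none with closed-cases G (λ u v u≢v ¬uv → ≰⇒> λ le → none (u , v , u≢v , ¬uv , le)) d≤degree few
    ...   | inj₁ Z            = inj₁ Z
    ...   | inj₂ (inj₁ shape) = inj₂ shape
    ...   | inj₂ (inj₂ o)     = viaEdge k G (s≤s⁻¹ missing<k) F⊆G d≤degree few w≢x ¬wx
      (tightPath⇒HamCycle w≢y y≢x t≢x ¬wy ¬xy yt ¬xt deg-wx deg-yx)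
      where open Obstacle o
    viaEdge k G missing≤k F⊆G d≤degree few {u} {v} u≢v ¬uv finish
      with go k (addEdge G u v u≢v) (<-≤-trans (missing-addEdge G u≢v ¬uv) missing≤k)
             (λ x y → inj₁ ∘ F⊆G x y)
             (λ x → ≤-trans (d≤degree x) (degree-⊆ {G = G} {addEdge G u v u≢v} (λ _ _ → inj₁) x))
             (fewLow-⊆ {G = G} {addEdge G u v u≢v} (λ _ _ → inj₁) few)
    ... | inj₁ Z     = inj₁ (Sum.[ id , finish ]′ (dropEdge F⊆G 3≤n u≢v Z))
    ... | inj₂ shape = inj₂ (shape-⊆ {G = G} {addEdge G u v u≢v} (λ _ _ → inj₁) shape)

-- Embedding into H and H′

-- Listing the vertices by increasing key κ, and by index among equal keys, puts those of
-- key below c into the first places.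
module _ {n : ℕ} (κ : Fin n → ℕ) where

  Before : Fin n → Fin n → Set
  Before w v = κ w < κ v ⊎ (κ w ≡ κ v × w Fin.< v)

  before? : ∀ w v → Dec (Before w v)
  before? w v = (κ w ℕ.<? κ v) ⊎-dec ((κ w ℕ.≟ κ v) ×-dec (w <? v))

  before-trans : ∀ {u v w} → Before u v → Before v w → Before u w
  before-trans (inj₁ p)       (inj₁ q)       = inj₁ (<-trans p q)
  before-trans (inj₁ p)       (inj₂ (q , _)) = inj₁ (<-≤-trans p (≤-reflexive q))
  before-trans (inj₂ (p , _)) (inj₁ q)       = inj₁ (≤-<-trans (≤-reflexive p) q)
  before-trans (inj₂ (p , r)) (inj₂ (q , s)) = inj₂ (trans p q , <-trans r s)

  before-irrefl : ∀ {v} → ¬ Before v v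
  before-irrefl (inj₁ p)       = <-irrefl refl p
  before-irrefl (inj₂ (_ , p)) = <-irrefl refl p

  before-total : ∀ u v → u ≢ v → Before u v ⊎ Before v u
  before-total u v u≢v with ℕ.<-cmp (κ u) (κ v) | <-cmp u v
  ... | tri< p _ _ | _            = inj₁ (inj₁ p)
  ... | tri> _ _ p | _            = inj₂ (inj₁ p)
  ... | tri≈ _ p _ | tri< q _ _   = inj₁ (inj₂ (p , q))
  ... | tri≈ _ p _ | tri≈ _ q _   = contradiction q u≢v
  ... | tri≈ _ p _ | tri> _ _ q   = inj₂ (inj₂ (sym p , q))

  rank : Fin n → ℕ
  rank v = # (λ w → before? w v)

  rank-< : ∀ {P : Fin n → Set} (P? : ∀ w → Dec (P w)) {v} → P v → (∀ w → Before w v → P w) → rank v < # P?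
  rank-< P? {v} Pv before⊆P = ≤-trans (≤-reflexive (cong (_+ rank v) (sym (#-singleton v))))
    (#-disjoint (_≟ v) (λ w → before? w v) P? (λ { _ refl → Pv }) before⊆P (λ { _ refl → before-irrefl }))

  rank<n : ∀ v → rank v < n
  rank<n v = ≤-trans (rank-< ⊤? _ _) (≤-reflexive (#-all ⊤? _))
    where
    ⊤? : (w : Fin n) → Dec Unit.⊤
    ⊤? _ = yes _

  rank-mono : ∀ {u v} → Before u v → rank u < rank v
  rank-mono {u} {v} uv = rank-< (λ w → before? w v) uv (λ w wu → before-trans wu uv)

  below? : ∀ c w → Dec (κ w < c)
  below? c w = κ w ℕ.<? c

  rank-below : ∀ {c} v → κ v < c → rank v < # (below? c)
  rank-below {c} v κv<c = rank-< (below? c) κv<c λ where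
    _ (inj₁ p)       → <-trans p κv<c
    _ (inj₂ (p , _)) → ≤-<-trans (≤-reflexive p) κv<c

  rank-above : ∀ {c} v → c ≤ κ v → # (below? c) ≤ rank v
  rank-above {c} v c≤κv = #-mono (below? c) (λ w → before? w v) (λ w κw<c → inj₁ (<-≤-trans κw<c c≤κv))

  place : Fin n → Fin n
  place v = fromℕ< (rank<n v)

  toℕ-place : ∀ v → toℕ (place v) ≡ rank v
  toℕ-place v = toℕ-fromℕ< (rank<n v)

  place-injective : Injective _≡_ _≡_ place
  place-injective {u} {v} eq with u ≟ v
  ... | yes u≡v = u≡v
  ... | no  u≢v = contradiction rank≡
    (Sum.[ <⇒≢ ∘ rank-mono , (λ vu → >⇒≢ (rank-mono vu)) ]′ (before-total u v u≢v))
    where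
    rank≡ : rank u ≡ rank v
    rank≡ = trans (sym (toℕ-place u)) (trans (cong toℕ eq) (toℕ-place v))

ShapeH⇒⊆H : ∀ {d ℓ} (G : Graph n) → ShapeH d ℓ G → G IsomorphicToSubgraphOf H n d ℓ
ShapeH⇒⊆H {n} {d} {ℓ} G (A , B , B⊆A , ∣A∣≡ , ∣B∣≡d , edges) = place κ , place-injective κ , embeds
  where
  -- The key is 0 on B, 1 on the rest of A and 2 outside A, which matches the order of the vertices
  -- of `H`.
  κ : Fin n → ℕ
  κ v = ⟦ ¬? (v ∈? A) ⟧ + ⟦ ¬? (v ∈? B) ⟧
  κ-B : ∀ {v} → v ∈ B → κ v < 1
  κ-B {v} v∈B rewrite ⟦⟧-false (¬? (v ∈? A)) (λ v∉A → v∉A (B⊆A v∈B))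
                  | ⟦⟧-false (¬? (v ∈? B)) (λ v∉B → v∉B v∈B) = ≤-refl
  κ-A : ∀ {v} → v ∈ A → κ v < 2
  κ-A {v} v∈A rewrite ⟦⟧-false (¬? (v ∈? A)) (λ v∉A → v∉A v∈A) = s≤s (⟦⟧≤1 (¬? (v ∈? B)))
  κ-∉B : ∀ {v} → v ∉ B → 1 ≤ κ v
  κ-∉B {v} v∉B rewrite ⟦⟧-true (¬? (v ∈? B)) v∉B = m≤n+m 1 _
  κ-∉A : ∀ {v} → v ∉ A → 2 ≤ κ v
  κ-∉A {v} v∉A rewrite ⟦⟧-true (¬? (v ∈? A)) v∉A = s≤s (≤-reflexive (sym (⟦⟧-true (¬? (v ∈? B)) (v∉A ∘ B⊆A))))
  #<1 : # (below? κ 1) ≡ d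
  #<1 = trans (#-cong (below? κ 1) (_∈? B)
    (λ v κv<1 → decidable-stable (v ∈? B) (λ v∉B → <⇒≱ κv<1 (κ-∉B v∉B))) (λ v → κ-B)) (trans (#∈ B) ∣B∣≡d)
  #<2 : # (below? κ 2) ≡ n ∸ d + ℓ
  #<2 = trans (#-cong (below? κ 2) (_∈? A)
    (λ v κv<2 → decidable-stable (v ∈? A) (λ v∉A → <⇒≱ κv<2 (κ-∉A v∉A))) (λ v → κ-A)) (trans (#∈ A) ∣A∣≡)
  inA : ∀ {v} → v ∈ A → toℕ (place κ v) < n ∸ d + ℓ
  inA {v} v∈A = subst₂ _<_ (sym (toℕ-place κ v)) #<2 (rank-below κ v (κ-A v∈A))
  inB : ∀ {v} → v ∈ B → toℕ (place κ v) < d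
  inB {v} v∈B = subst₂ _<_ (sym (toℕ-place κ v)) #<1 (rank-below κ v (κ-B v∈B))
  notA : ∀ {v} → v ∉ A → ¬ toℕ (place κ v) < n ∸ d + ℓ
  notA {v} v∉A = ≤⇒≯ (subst₂ _≤_ #<2 (sym (toℕ-place κ v)) (rank-above κ v (κ-∉A v∉A)))
  embeds : ∀ u v → Adj G u v → Adj (H n d ℓ) (place κ u) (place κ v)
  embeds u v uv with adj⇒≢ G uv ∘ place-injective κ | edges u v uv
  ... | ≢ | inj₁ (u∈A , v∈A)        = ≢ , inj₁ (inj₁ (inA u∈A , inA v∈A))
  ... | ≢ | inj₂ (inj₁ (u∈B , v∉A)) = ≢ , inj₁ (inj₂ (inB u∈B , notA v∉A))
  ... | ≢ | inj₂ (inj₂ (v∈B , u∉A)) = ≢ , inj₂ (inj₂ (inB v∈B , notA u∉A))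

ShapeH′⇒⊆H′ : ∀ {d ℓ} (G : Graph n) → ShapeH′ d ℓ G → G IsomorphicToSubgraphOf H′ n d ℓ
ShapeH′⇒⊆H′ {n} {d} {ℓ} G (P , Q , ∣P∣≡ , ∣Q∣≡ , cover , edges) = place κ , place-injective κ , embeds
  where
  -- The key is 0 on P outside Q, 1 on the overlap and 2 on Q outside P, so P comes first and Q
  -- last.
  κ : Fin n → ℕ
  κ v = ⟦ ¬? (v ∈? P) ⟧ + ⟦ v ∈? Q ⟧
  κ-P : ∀ {v} → v ∈ P → κ v < 2
  κ-P {v} v∈P rewrite ⟦⟧-false (¬? (v ∈? P)) (λ v∉P → v∉P v∈P) = s≤s (⟦⟧≤1 (v ∈? Q))
  κ-∉P : ∀ {v} → v ∉ P → 2 ≤ κ v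
  κ-∉P {v} v∉P rewrite ⟦⟧-true (¬? (v ∈? P)) v∉P with cover v
  ... | inj₁ v∈P = contradiction v∈P v∉P
  ... | inj₂ v∈Q = s≤s (≤-reflexive (sym (⟦⟧-true (v ∈? Q) v∈Q)))
  κ-Q : ∀ {v} → v ∈ Q → 1 ≤ κ v
  κ-Q {v} v∈Q rewrite ⟦⟧-true (v ∈? Q) v∈Q = m≤n+m 1 _
  κ-∉Q : ∀ {v} → v ∉ Q → κ v < 1
  κ-∉Q {v} v∉Q rewrite ⟦⟧-false (v ∈? Q) v∉Q with cover v
  ... | inj₁ v∈P = s≤s (≤-reflexive (trans (+-identityʳ _) (⟦⟧-false (¬? (v ∈? P)) (λ v∉P → v∉P v∈P))))
  ... | inj₂ v∈Q = contradiction v∈Q v∉Q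
  #<2 : # (below? κ 2) ≡ n ∸ d + ℓ
  #<2 = trans (#-cong (below? κ 2) (_∈? P)
    (λ v κv<2 → decidable-stable (v ∈? P) (λ v∉P → <⇒≱ κv<2 (κ-∉P v∉P))) (λ v → κ-P)) (trans (#∈ P) ∣P∣≡)
  -- The vertices outside Q precede all of Q, so their number bounds the places of Q from below.
  ≤#<1 : n ∸ suc d ≤ # (below? κ 1)
  ≤#<1 = m≤n+o⇒m∸n≤o n (suc d) (begin
    n                                     ≡⟨ #-complement (_∈? Q) ⟨
    # (λ v → ¬? (v ∈? Q)) + # (_∈? Q)     ≤⟨ +-mono-≤ (#-mono (λ v → ¬? (v ∈? Q)) (below? κ 1) (λ v → κ-∉Q))
                                                      (≤-reflexive (trans (#∈ Q) ∣Q∣≡)) ⟩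
    # (below? κ 1) + suc d                ≡⟨ +-comm _ (suc d) ⟩
    suc d + # (below? κ 1)                ∎)
    where open ≤-Reasoning
  inP : ∀ {v} → v ∈ P → toℕ (place κ v) < n ∸ d + ℓ
  inP {v} v∈P = subst₂ _<_ (sym (toℕ-place κ v)) #<2 (rank-below κ v (κ-P v∈P))
  inQ : ∀ {v} → v ∈ Q → n ∸ suc d ≤ toℕ (place κ v)
  inQ {v} v∈Q = ≤-trans ≤#<1 (≤-trans (rank-above κ v (κ-Q v∈Q)) (≤-reflexive (sym (toℕ-place κ v))))
  embeds : ∀ u v → Adj G u v → Adj (H′ n d ℓ) (place κ u) (place κ v)
  embeds u v uv with adj⇒≢ G uv ∘ place-injective κ | edges u v uv
  ... | ≢ | inj₁ (u∈P , v∈P) = ≢ , inj₁ (inP u∈P , inP v∈P)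
  ... | ≢ | inj₂ (u∈Q , v∈Q) = ≢ , inj₂ (inQ u∈Q , inQ v∈Q)

-- The negation of ℓ-hamiltonicity does not hand over a forest F constructively. Deciding the shape
-- first allows ℓ-hamiltonicity to be proved, for all F, from the absence of a shape.
shape? : ∀ d ℓ (G : Graph n) → Dec (Shape d ℓ G)
shape? {n} d ℓ G =
  anySubset? (λ A → anySubset? λ B → (B ⊆? A) ×-dec ((∣ A ∣ ℕ.≟ n ∸ d + ℓ) ×-dec ((∣ B ∣ ℕ.≟ d) ×-dec
    all? λ u → all? λ v → adj? G u v →-dec
      (((u ∈? A) ×-dec (v ∈? A)) ⊎-dec (((u ∈? B) ×-dec ¬? (v ∈? A)) ⊎-dec ((v ∈? B) ×-dec ¬? (u ∈? A)))))))
  ⊎-dec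
  anySubset? (λ P → anySubset? λ Q → (∣ P ∣ ℕ.≟ n ∸ d + ℓ) ×-dec ((∣ Q ∣ ℕ.≟ suc d) ×-dec
    ((all? λ v → (v ∈? P) ⊎-dec (v ∈? Q)) ×-dec
    (all? λ u → all? λ v → adj? G u v →-dec
      (((u ∈? P) ×-dec (v ∈? P)) ⊎-dec ((u ∈? Q) ×-dec (v ∈? Q)))))))

-- Minimum degree, halves and the conclusion

δ≤degree : (G : Graph n) (v : Fin n) → δ G ≤ degree G v
δ≤degree {n} G v = All.lookup (min≤xs n (map (degree G) (allFin n))) (∈-map⁺ (degree G) (∈-allFin v))

⌊n/2⌋+⌊n/2⌋≤n : ∀ n → ⌊ n /2⌋ + ⌊ n /2⌋ ≤ n
⌊n/2⌋+⌊n/2⌋≤n n = ≤-trans (+-monoʳ-≤ ⌊ n /2⌋ (⌊n/2⌋≤⌈n/2⌉ n)) (≤-reflexive (⌊n/2⌋+⌈n/2⌉≡n n))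

m+m≤n⇒m≤⌊n/2⌋ : ∀ {m n} → m + m ≤ n → m ≤ ⌊ n /2⌋
m+m≤n⇒m≤⌊n/2⌋ {m} m+m≤n = ≤-trans (≤-reflexive (n≡⌊n+n/2⌋ m)) (⌊n/2⌋-mono m+m≤n)

theorem5 : (n r d ℓ : ℕ) → n ≥ 3 → r ≥ 2 → ℓ < d → d ≤ ⌊ n + ℓ ∸ 1 /2⌋ →
    (G : Graph n) → ¬ (ℓ -Hamiltonian G) → δ G ≥ d →
    cliqueCount G r > h r n (d + 1) ℓ ⊔ h r n ⌊ n + ℓ ∸ 1 /2⌋ ℓ →
    (G IsomorphicToSubgraphOf H n d ℓ) ⊎ (G IsomorphicToSubgraphOf H′ n d ℓ)
theorem5 n@(suc n′) (suc s) d ℓ 3≤n 2≤r ℓ<d d≤m G ¬ham d≤δ many with shape? d ℓ G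
... | yes shape = Sum.map (ShapeH⇒⊆H G) (ShapeH′⇒⊆H′ G) shape
... | no ¬shape = contradiction hamiltonian ¬ham
  where
  -- As n is a successor, `n + ℓ ∸ 1` reduces to `n′ + ℓ`.
  m = ⌊ n′ + ℓ /2⌋
  2m<n+ℓ : m + m < n + ℓ
  2m<n+ℓ = s≤s (⌊n/2⌋+⌊n/2⌋≤n (n′ + ℓ))
  -- From ℓ < d ≤ m one gets m + ℓ ≤ 2m < n + ℓ.
  m≤n : m ≤ n
  m≤n = +-cancelʳ-≤ ℓ m n (≤-trans (+-monoʳ-≤ m (<⇒≤ (<-≤-trans ℓ<d d≤m))) (<⇒≤ 2m<n+ℓ))
  hamiltonian : ℓ -Hamiltonian G
  hamiltonian F forest refl F⊆G = Sum.[ toHamiltonianCycle 3≤n , (λ shape → contradiction shape ¬shape) ]′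
    (HamCycle⊎Shape {n} {d} {m} {F} forest 3≤n ℓ<d d≤m 2m<n+ℓ (λ _ lt → m+m≤n⇒m≤⌊n/2⌋ (s≤s⁻¹ lt)) G F⊆G
      (λ v → ≤-trans d≤δ (δ≤degree G v)) (fewLow G s d (edgeCount F) m ℓ<d d≤m m≤n many))
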